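{- Let $SG$ be a signed intersection graph and let $v_1,v_2\in V(SG)$. If $v_1$ and $v_2$ are adjacent, the degree of $v_1$ is $1$, and the sign of $v_1$ is positive, then $$IP_{SG}(z)=IP_{SG-v_1}(z)+(2z^{2})\,IP_{SG-v_1-v_2}(z).$$
   Context: Ribbon graphs are finite, possibly non-orientable. For a ribbon graph $G$, let $v(G),e(G),f(G)$ be its numbers of vertices, edges and boundary components. For connected $G$ the Euler genus $\varepsilon(G)$ is defined by $2-\varepsilon(G)=v(G)-e(G)+f(G)$. For $A\subseteq E(G)$ the partial dual $G^{A}$ is obtained as follows: take the spanning ribbon subgraph $(V(G),A)$, glue a disc to $G$ along each boundary component of this subgraph (these discs are the vertex-discs of $G^A$), and remove the interiors of all vertex-discs of $G$; the edge-ribbons are kept as the edges of $G^A$. The partial-dual Euler genus polynomial of $G$ is ${}^{\partial}\varepsilon_{G}(z)=\sum_{A\subseteq E(G)}z^{\varepsilon(G^{A})}$. A bouquet is a ribbon graph with exactly one vertex (the bouquet without edges is allowed; its signed intersection graph is the empty graph). A loop $e$ at the vertex-disc $v$ is twisted if $e\cup v$ is homeomorphic to a Möbius band, and untwisted otherwise. The intersection graph $I(B)$ of a bouquet $B$ is the graph with vertex set $E(B)$ in which distinct $e$ and $f$ are adjacent if and only if their ends are met in the cyclic order $e\cdots f\cdots e\cdots f\cdots$ when travelling around the boundary of the unique vertex of $B$. The signed intersection graph $SI(B)$ is $I(B)$ together with a sign at each vertex: $+$ if the corresponding edge of $B$ is an untwisted loop, $-$ if it is a twisted loop. A graph $SG$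 with a sign $+$ or $-$ at each vertex is called a signed intersection graph if $SG=SI(B)$ for some bouquet $B$. Its intersection polynomial is $IP_{SG}(z):={}^{\partial}\varepsilon_{B}(z)$ for any bouquet $B$ with $SG=SI(B)$; this does not depend on the choice of $B$, since bouquets with the same signed intersection graph have the same partial-dual Euler genus polynomial. $SG-v$ denotes deletion of the vertex $v$ (the other vertices keep their signs); deleting vertices from a signed intersection graph gives a signed intersection graph, since it corresponds to deleting edges of the bouquet. -}

module Defs where

open import Data.Bool.Base using (Bool; true; false; not; if_then_else_)
import Data.Bool.Properties as Bool
open import Data.Fin.Base using (Fin; zero; suc; punchIn)
import Data.Fin.Properties as Fin
open import Data.Fin.Permutation using (Permutation′; _⟨$⟩ʳ_)
open import Data.Fin.Subset using (Subset; inside; outside; ∣_∣)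
open import Data.List.Base
  using (List; []; _∷_; _++_; map; foldr; length; replicate; iterate; allFin; deduplicate;
         cartesianProduct)
import Data.List.Membership.DecPropositional as DecMembership
import Data.List.Relation.Binary.Sublist.DecPropositional as DecSublist
open import Data.Nat.Base using (ℕ; zero; suc; _+_; _*_; _∸_)
open import Data.Product.Base using (Σ; _×_; _,_; proj₁)
import Data.Product.Properties as Product
open import Data.Sign.Base using (Sign)
open import Data.Sum.Base using (_⊎_; swap)
import Data.Vec.Base as Vec
open import Function.Base using (_∘_)
open import Function.Bundles using (mk⇔)
open import Relation.Binary.Definitions using (Decidable; DecidableEquality)
open import Relation.Binary.PropositionalEquality
  using (_≡_; _≢_; refl; sym; trans; cong)
open import Relation.Nullary.Decidable
  using (Dec; does; ¬?; _×-dec_; _⊎-dec_; does-⇔; dec-false)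

-- Coefficients, constant term first.  Trailing zeros are allowed, so
-- equality of polynomials is _≈_, not _≡_.
Poly : Set
Poly = List ℕ

coeff : Poly → ℕ → ℕ
coeff []      _       = 0
coeff (a ∷ p) zero    = a
coeff (a ∷ p) (suc k) = coeff p k

infix 4 _≈_
_≈_ : Poly → Poly → Set
p ≈ q = ∀ k → coeff p k ≡ coeff q k

infixl 6 _⊕_
_⊕_ : Poly → Poly → Poly
[]      ⊕ q       = q
(a ∷ p) ⊕ []      = a ∷ p
(a ∷ p) ⊕ (b ∷ q) = (a + b) ∷ (p ⊕ q)

infixl 7 _⊛_
_⊛_ : Poly → Poly → Poly
[]      ⊛ q = []
(a ∷ p) ⊛ q = map (a *_) q ⊕ (0 ∷ (p ⊛ q))

infix 8 _z^_
_z^_ : ℕ → ℕ → Poly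
c z^ k = replicate k 0 ++ c ∷ []

-- An edge-ribbon is a rectangle with four corners ("flags").  The flag
-- (e , i , s) is the corner of e at end i ∈ {false, true} (the two arcs
-- glued to vertex-discs) on side s ∈ {false, true} (the two free arcs).
Flag : ℕ → Set
Flag n = Fin n × Bool × Bool

edgeOf : ∀ {n} → Flag n → Fin n
edgeOf = proj₁

acrossEnd : ∀ {n} → Flag n → Flag n
acrossEnd (e , i , s) = e , i , not s

alongSide : ∀ {n} → Flag n → Flag n
alongSide (e , i , s) = e , not i , s

flags : ∀ n → List (Flag n)
flags n = cartesianProduct (allFin n) (cartesianProduct bits bits)
  where bits = false ∷ true ∷ []

infix 4 _≟ᶠ_
_≟ᶠ_ : ∀ {n} → DecidableEquality (Flag n)
_≟ᶠ_ = Product.≡-dec Fin._≟_ (Product.≡-dec Bool._≟_ Bool._≟_)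

-- A ribbon graph with edge set Fin n.  Between the edge-ends, the boundary
-- of the vertex-discs consists of arcs joining two flags each; `arc` sends a
-- flag to the other endpoint of its arc.  Any fixed-point-free involution
-- occurs, orientable or not.  Vertex-discs that meet no edge carry no flag
-- and are only counted.
record RibbonGraph (n : ℕ) : Set where
  field
    isolated       : ℕ
    arc            : Flag n → Flag n
    arc-involutive : ∀ x → arc (arc x) ≡ x
    arc-fixfree    : ∀ x → arc x ≢ x

open RibbonGraph public

-- If a and b are fixed-point-free involutions, the pairs {x , a x} and
-- {x , b x} fit together into closed curves.  `trace a b k x` lists the
-- first k flags met on the curve through x, starting with an a-step.
trace : ∀ {n} → (a b : Flag n → Flag n) → ℕ → Flag n → List (Flag n)
trace a b zero    x = []
trace a b (suc k) x = x ∷ trace b a k (a x)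

module _ {n : ℕ} where
  open DecMembership (_≟ᶠ_ {n}) public using (_∈_; _∈?_)

-- There are 4n flags, so 4n steps go around the whole curve.
SameCurve : ∀ {n} → (a b : Flag n → Flag n) → Flag n → Flag n → Set
SameCurve {n} a b x y = y ∈ trace a b (4 * n) x

sameCurve? : ∀ {n} (a b : Flag n → Flag n) → Decidable (SameCurve a b)
sameCurve? {n} a b x y = y ∈? trace a b (4 * n) x

#curves : ∀ {n} → (a b : Flag n → Flag n) → ℕ
#curves {n} a b = length (deduplicate (sameCurve? a b) (flags n))

module _ {n : ℕ} (G : RibbonGraph n) where

  #vertices : ℕ
  #vertices = #curves (arc G) acrossEnd + isolated G

  #edges : ℕ
  #edges = n

  #boundaries : ℕ
  #boundaries = #curves (arc G) alongSide + isolated G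

  -- 2 - ε = v - e + f.  Meaningful for connected G only; there
  -- v + f ≤ 2 + e, so the subtraction is not truncated.
  eulerGenus : ℕ
  eulerGenus = (2 + #edges) ∸ (#vertices + #boundaries)

-- Exchanges the ends and the sides of the ribbons in A.
exchange : ∀ {n} → Subset n → Flag n → Flag n
exchange A (e , i , s) = if Vec.lookup A e then (e , s , i) else (e , i , s)

exchange-involutive : ∀ {n} (A : Subset n) x → exchange A (exchange A x) ≡ x
exchange-involutive A (e , i , s) with Vec.lookup A e in eq
... | true  rewrite eq = refl
... | false rewrite eq = refl

-- The boundary of the spanning ribbon subgraph (V(G) , A) consists of the
-- arcs of G, the sides of the ribbons in A, and the end-arcs of the ribbons
-- outside A.  The discs glued along it are the vertex-discs of the partial
-- dual: the arcs are unchanged, and a ribbon in A is attached to the new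
-- discs along its former sides.
infixl 8 _^_
_^_ : ∀ {n} → RibbonGraph n → Subset n → RibbonGraph n
G ^ A = record
  { isolated       = isolated G
  ; arc            = λ x → σ (arc G (σ x))
  ; arc-involutive = λ x →
      trans (cong (σ ∘ arc G) (σσ (arc G (σ x))))
      (trans (cong σ (arc-involutive G (σ x))) (σσ x))
  ; arc-fixfree    = λ x eq →
      arc-fixfree G (σ x) (trans (sym (σσ (arc G (σ x)))) (cong σ eq))
  }
  where
  σ  = exchange A
  σσ = exchange-involutive A

subsets : ∀ n → List (Subset n)
subsets zero    = Vec.[] ∷ []
subsets (suc n) = map (outside Vec.∷_) (subsets n) ++ map (inside Vec.∷_) (subsets n)

∂ε : ∀ {n} → RibbonGraph n → Poly
∂ε {n} G = foldr _⊕_ [] (map (λ A → 1 z^ eulerGenus (G ^ A)) (subsets n))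

record SignedGraph (n : ℕ) : Set where
  field
    adj        : Fin n → Fin n → Bool
    adj-sym    : ∀ u v → adj u v ≡ adj v u
    adj-irrefl : ∀ v → adj v v ≡ false
    sign       : Fin n → Sign

open SignedGraph public

Adjacent : ∀ {n} → SignedGraph n → Fin n → Fin n → Set
Adjacent SG u v = adj SG u v ≡ true

Adjacent⇒≢ : ∀ {n} (SG : SignedGraph n) {u v} → Adjacent SG u v → u ≢ v
Adjacent⇒≢ SG {u} uv refl with trans (sym uv) (adj-irrefl SG u)
... | ()

degree : ∀ {n} → SignedGraph n → Fin n → ℕ
degree SG v = ∣ Vec.tabulate (adj SG v) ∣

infixl 6 _-_
_-_ : ∀ {n} → SignedGraph (suc n) → Fin (suc n) → SignedGraph n
SG - v = record
  { adj        = λ u w → adj SG (punchIn v u) (punchIn v w)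
  ; adj-sym    = λ u w → adj-sym SG (punchIn v u) (punchIn v w)
  ; adj-irrefl = λ u → adj-irrefl SG (punchIn v u)
  ; sign       = λ u → sign SG (punchIn v u)
  }

infix 4 _≅_
record _≅_ {n} (SG SH : SignedGraph n) : Set where
  field
    bijection : Permutation′ n
    adj-≡     : ∀ u v → adj SG u v ≡ adj SH (bijection ⟨$⟩ʳ u) (bijection ⟨$⟩ʳ v)
    sign-≡    : ∀ v → sign SG v ≡ sign SH (bijection ⟨$⟩ʳ v)

record Bouquet (n : ℕ) : Set where
  field
    graph      : RibbonGraph n
    one-vertex : #vertices graph ≡ 1

open Bouquet public

-- Travelling once around the boundary of the vertex, the flags at which the
-- 2n edge-ends are entered, in order.
tour : ∀ {n} → Bouquet n → List (Flag n)
tour {zero}  B = []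
tour {suc n} B =
  iterate (arc (graph B) ∘ acrossEnd) (zero , false , false) (2 * suc n)

module _ {n : ℕ} (B : Bouquet n) where

  open DecSublist (Fin._≟_ {n}) using (_⊆_; _⊆?_)

  Interlaced : Fin n → Fin n → Set
  Interlaced e f = e ≢ f ×
    ( (e ∷ f ∷ e ∷ f ∷ []) ⊆ map edgeOf (tour B)
    ⊎ (f ∷ e ∷ f ∷ e ∷ []) ⊆ map edgeOf (tour B))

  interlaced? : Decidable Interlaced
  interlaced? e f = ¬? (e Fin.≟ f) ×-dec
    (((e ∷ f ∷ e ∷ f ∷ []) ⊆? map edgeOf (tour B))
     ⊎-dec ((f ∷ e ∷ f ∷ e ∷ []) ⊆? map edgeOf (tour B)))

  interlaced-sym : ∀ {e f} → Interlaced e f → Interlaced f e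
  interlaced-sym (e≢f , w) = e≢f ∘ sym , swap w

  -- The sides of a ribbon join (e , false , s) to (e , true , s).  If both
  -- ends are entered on the same side, the vertex-disc and the ribbon
  -- cannot be oriented consistently, so together they form a Möbius band;
  -- if they are entered on opposite sides, they form an annulus.
  Twisted : Fin n → Set
  Twisted e = BothEnteredOn false ⊎ BothEnteredOn true
    where
    BothEnteredOn : Bool → Set
    BothEnteredOn s = (e , false , s) ∈ tour B × (e , true , s) ∈ tour B

  twisted? : ∀ e → Dec (Twisted e)
  twisted? e =
    (((e , false , false) ∈? tour B) ×-dec ((e , true , false) ∈? tour B))
    ⊎-dec
    (((e , false , true) ∈? tour B) ×-dec ((e , true , true) ∈? tour B))

  SI : SignedGraph n
  SI = record
    { adj        = λ e f → does (interlaced? e f)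
    ; adj-sym    = λ e f → does-⇔ (mk⇔ interlaced-sym interlaced-sym)
                                   (interlaced? e f) (interlaced? f e)
    ; adj-irrefl = λ e → dec-false (interlaced? e e) (λ (e≢e , _) → e≢e refl)
    ; sign       = λ e → if does (twisted? e) then Sign.- else Sign.+
    }

IsSignedIntersectionGraph : ∀ {n} → SignedGraph n → Set
IsSignedIntersectionGraph {n} SG = Σ (Bouquet n) λ B → SG ≅ SI B

-- Computed from the bouquet in the witness; a statement about IP for all
-- witnesses is therefore a statement about every bouquet representing SG.
IP : ∀ {n} (SG : SignedGraph n) → IsSignedIntersectionGraph SG → Poly
IP SG (B , _) = ∂ε (graph B)

module Submission where

-- A 2-colouring of the boundary components of the spanning ribbon subgraph
-- (V(B) , A) of a bouquet B, read off along the boundary of the vertex,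
-- changes at both ends of e ∈ A by the same bit x e and at no other place.
-- That the two sides of every e ∈ A are coloured consistently means that x
-- lies in the kernel of M[A], where M is the adjacency matrix of SI(B) over
-- GF(2) with ones on the diagonal at the negative vertices.  Counting the
-- colourings, f(A) = 1 + corank M[A], so ε(B^A) = rank M[A] + rank M[∁ A].
-- If v₁ is a positive leaf with neighbour v₂, then rank M[A] is
-- 2 + rank M[A ∖ {v₁,v₂}] for v₁, v₂ ∈ A, and rank M[A ∖ {v₁}] for v₁ ∈ A,
-- v₂ ∉ A; the recurrence follows by splitting the sum over A in four.

open import Defs
open import Algebra.Bundles using (CommutativeRing)
open import Data.Bool.Base using (Bool; true; false; not; _∧_; _xor_; if_then_else_)
open import Data.Bool.Properties as Bool
  using (not-involutive; not-¬; ¬-not; ∧-zeroʳ; ∧-identityʳ; xor-identityʳ; xor-same; xor-assoc; xor-comm;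
         xor-∧-commutativeRing)
open import Data.Fin.Base as Fin using (Fin; zero; suc; toℕ; fromℕ<; punchIn; punchOut; _↑ˡ_; _↑ʳ_; splitAt)
import Data.Fin.Properties as Fin
open import Data.Fin.Permutation as Perm using (_⟨$⟩ʳ_; _⟨$⟩ˡ_)
open import Data.Fin.Subset as Subset using (Subset; ∁; ∣_∣; inside; outside)
import Data.Fin.Subset.Properties as Subset
open import Data.List.Base as List using (List; []; _∷_; _++_; map; foldr; iterate; deduplicate)
open import Data.List.Membership.Propositional using () renaming (_∈_ to _∈ˡ_)
open import Data.List.Membership.Propositional.Properties
  using (∈-++⁺ˡ; ∈-++⁺ʳ; ∈-map⁺; ∈-map⁻; ∈-cartesianProduct⁺; ∈-allFin; ∈-lookup)
open import Data.List.Membership.Propositional.Properties.WithK using (unique∧set⇒bag)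
open import Data.List.Properties using (map-++; map-∘; map-cong)
open import Data.List.Relation.Binary.BagAndSetEquality using (∼bag⇒↭)
open import Data.List.Relation.Binary.Permutation.Propositional using (_↭_)
import Data.List.Relation.Binary.Permutation.Propositional.Properties as ↭
open import Data.List.Relation.Binary.Sublist.Propositional using (_⊆_; _∷_; _∷ʳ_; from∈; to∈; minimum)
open import Data.List.Relation.Binary.Sublist.Propositional.Properties using (++⁺)
open import Data.List.Relation.Unary.All as All using ([])
open import Data.List.Relation.Unary.AllPairs using ([]; _∷_)
open import Data.List.Relation.Unary.Any as Any using (Any; here; there; index)
open import Data.List.Relation.Unary.Any.Properties using (lookup-index)
  renaming (deduplicate⁺ to Any-deduplicate⁺)
import Data.List.Relation.Unary.Unique.DecSetoid.Properties as DecUnique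
open import Data.List.Relation.Unary.Unique.Propositional using (Unique)
import Data.List.Relation.Unary.Unique.Propositional.Properties as Unique
import Data.List.Relation.Unary.Unique.Setoid as Setoid
open import Data.Nat.Base as ℕ using (ℕ; zero; suc; pred; _+_; _*_; _∸_; _≤_; _<_; s≤s; z≤n; z<s)
open import Data.Nat.GeneralisedArithmetic using () renaming (iterate to iter)
import Data.Nat.ListAction as ℕ
import Data.Nat.ListAction.Properties as ℕ
import Data.Nat.Properties as ℕ
open import Data.Nat.Tactic.RingSolver using (solve-∀)
open import Data.Product.Base using (∃; ∃₂; _×_; _,_; proj₁; proj₂)
open import Data.Product.Function.NonDependent.Propositional using (_×-↔_)
open import Data.Product.Function.NonDependent.Setoid using (_×-inverse_)
open import Data.Product.Relation.Binary.Pointwise.NonDependent using (×-setoid)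
open import Data.Sign.Base as Sign using (Sign)
open import Data.Sum.Base using (_⊎_; inj₁; inj₂)
open import Data.Vec.Base as Vec using (lookup; insertAt; tabulate)
import Data.Vec.Functional as F
import Data.Vec.Functional.Properties as F
import Data.Vec.Properties as Vec
open import Function.Base using (_∘_)
open import Function.Bundles using (Inverse; Injection; _↔_; mk⇔)
open import Function.Construct.Composition using (_↔-∘_) renaming (inverse to _∘ᴵ_)
open import Function.Construct.Identity using (↔-id) renaming (inverse to idᴵ)
open import Function.Construct.Symmetry using (↔-sym) renaming (inverse to symᴵ)
open import Function.Definitions using (Injective)
open import Function.Properties.Inverse using (↔⇒↣)
open import Level using (0ℓ)
open import Relation.Binary.Bundles using (Setoid; DecSetoid)
import Relation.Binary.Construct.On as On
open import Relation.Binary.Definitions using (tri<; tri≈; tri>)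
open import Relation.Binary.PropositionalEquality
open import Relation.Nullary using (Dec; does; yes; no; contradiction; ¬_)
open import Relation.Nullary.Decidable using (dec-true; dec-false; map′; _×-dec_; from-yes)
open import Algebra.Properties.CommutativeMonoid.Sum (CommutativeRing.+-commutativeMonoid xor-∧-commutativeRing)
  using (sum; sum-cong-≗; sum-remove; sum-permute; sum-replicate-zero; ∑-distrib-+)
open import Algebra.Properties.CommutativeSemigroup ℕ.+-commutativeSemigroup using (interchange)

-- The witnesses `h`, `h₁` and `h₁₂` carry three unrelated bouquets, so no deletion of edges can be
-- followed inside one ribbon graph. Each polynomial is therefore first described by coranks of the
-- signed graph alone (`CountsGenera`), and the recurrence compares only these descriptions. Partial
-- duality enters through conjugation by `exchange A`: it identifies the vertices of B^A with the
-- boundary components of (V(B) , A), and the boundary components of B^A with those of (V(B) , ∁ A).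
-- This is where the second rank comes from. No dimension theory is set up: a number of curves is
-- recovered as the exponent k of a bijection with `Cube k`, and the summand 1 beside the corank is
-- the colour of a base flag, which may be chosen freely. Complementing A exchanges the two ranks,
-- so only two of the four cases at the leaf need a computation of kernels.

private variable
  X : Set
  n : ℕ

-- Orbits of a pair of involutions

iter-suc : ∀ (f : X → X) x k → iter f x (suc k) ≡ f (iter f x k)
iter-suc f x zero    = refl
iter-suc f x (suc k) = iter-suc f (f x) k

iter-+ : ∀ (f : X → X) x j k → iter f x (j + k) ≡ iter f (iter f x j) k
iter-+ f x zero    k = refl
iter-+ f x (suc j) k = iter-+ f (f x) j k

iter-injective : ∀ (f : X → X) → Injective _≡_ _≡_ f → ∀ k → Injective _≡_ _≡_ (λ x → iter f x k)
iter-injective f inj zero    eq = eq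
iter-injective f inj (suc k) eq = inj (iter-injective f inj k eq)

involutive⇒injective : (f : X → X) → (∀ x → f (f x) ≡ x) → Injective _≡_ _≡_ f
involutive⇒injective f ff {x} {y} eq = trans (sym (ff x)) (trans (cong f eq) (ff y))

↔-injective : ∀ {X Y : Set} (f : X ↔ Y) → Injective _≡_ _≡_ (Inverse.to f)
↔-injective f = Injection.injective (↔⇒↣ f)

half↔ : ∀ {L} → Fin (L * 2) ↔ (Fin L × Bool)
half↔ = (↔-id _ ×-↔ Fin.2↔Bool) ↔-∘ Fin.*↔×

halve : ∀ L → Fin (L * 2) → Fin L × Bool
halve L = Inverse.to half↔

flag↔Fin : Flag n ↔ Fin (n * 4)
flag↔Fin = ↔-sym Fin.*↔× ↔-∘ (↔-id _ ×-↔ (↔-sym Fin.*↔× ↔-∘ (↔-sym Fin.2↔Bool ×-↔ ↔-sym Fin.2↔Bool)))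

∈-flags : (y : Flag n) → y ∈ flags n
∈-flags (e , i , s) = ∈-cartesianProduct⁺ (∈-allFin e) (∈-cartesianProduct⁺ (∈-bits i) (∈-bits s))
  where
  ∈-bits : ∀ b → Any (b ≡_) (false ∷ true ∷ [])
  ∈-bits false = here refl
  ∈-bits true  = there (here refl)

-- `SameCurve` is membership in a list of fixed length, for which symmetry and transitivity are not
-- evident. The inductive closure has both, and the two relations are later shown to agree.
data Orbit {X : Set} (a b : X → X) (x : X) : X → Set where
  start : Orbit a b x x
  stepᵃ : ∀ {y} → Orbit a b x y → Orbit a b x (a y)
  stepᵇ : ∀ {y} → Orbit a b x y → Orbit a b x (b y)

Orbit-swap : ∀ {a b : X → X} {x y} → Orbit a b x y → Orbit b a x y
Orbit-swap start     = start
Orbit-swap (stepᵃ o) = stepᵇ (Orbit-swap o)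
Orbit-swap (stepᵇ o) = stepᵃ (Orbit-swap o)

Orbit-trans : ∀ {a b : X → X} {x y z} → Orbit a b x y → Orbit a b y z → Orbit a b x z
Orbit-trans o start      = o
Orbit-trans o (stepᵃ o′) = stepᵃ (Orbit-trans o o′)
Orbit-trans o (stepᵇ o′) = stepᵇ (Orbit-trans o o′)

module Involutions {X : Set} (a b : X → X)
  (aa : ∀ x → a (a x) ≡ x) (bb : ∀ x → b (b x) ≡ x) where

  rotate : X → X
  rotate = b ∘ a

  rotate-injective : Injective _≡_ _≡_ rotate
  rotate-injective = involutive⇒injective a aa ∘ involutive⇒injective b bb

  Orbit-sym : ∀ {x y} → Orbit a b x y → Orbit a b y x
  Orbit-sym start = start
  Orbit-sym {x} (stepᵃ {y} o) = Orbit-trans (subst (Orbit a b (a y)) (aa y) (stepᵃ start)) (Orbit-sym o)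
  Orbit-sym {x} (stepᵇ {y} o) = Orbit-trans (subst (Orbit a b (b y)) (bb y) (stepᵇ start)) (Orbit-sym o)

  -- Two involutions generate a dihedral group, so an orbit consists of the powers of `rotate`
  -- applied to x and their images under `a`.
  OnCycle : ℕ → X → X → Set
  OnCycle q x y = ∃ λ j → j < q × (y ≡ iter rotate x j ⊎ y ≡ a (iter rotate x j))

  -- b (rotate z) = a z, so a b-step leads backwards along the powers of rotate.
  opaque
    onCycle : ∀ {q x y} → iter rotate x (suc q) ≡ x → Orbit a b x y → OnCycle (suc q) x y
    onCycle period start = 0 , z<s , inj₁ refl
    onCycle period (stepᵃ o) with onCycle period o
    ... | j , j<q , inj₁ refl = j , j<q , inj₂ refl
    ... | j , j<q , inj₂ refl = j , j<q , inj₁ (aa _)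
    onCycle {q} {x} period (stepᵇ o) with onCycle period o
    ... | zero  , j<q , inj₁ refl =
      q , ℕ.≤-refl , inj₂ (trans (cong b (trans (sym period) (iter-suc rotate x q))) (bb _))
    ... | suc j , j<q , inj₁ refl =
      j , ℕ.<-trans (ℕ.n<1+n j) j<q , inj₂ (trans (cong b (iter-suc rotate x j)) (bb _))
    ... | j , s≤s j≤q , inj₂ refl with ℕ.m≤n⇒m<n∨m≡n j≤q
    ...   | inj₁ j<q  = suc j , s≤s j<q , inj₁ (sym (iter-suc rotate x j))
    ...   | inj₂ refl = 0 , z<s , inj₁ (trans (sym (iter-suc rotate x j)) period)

  iter-∸ : ∀ x {i j} → i ≤ j → iter rotate x i ≡ iter rotate x j → iter rotate x (j ∸ i) ≡ x
  iter-∸ x {i} {j} i≤j eq = iter-injective rotate rotate-injective i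
    (trans (sym (iter-+ rotate x (j ∸ i) i)) (trans (cong (iter rotate x) (ℕ.m∸n+n≡m i≤j)) (sym eq)))

  module _ (a≢ : ∀ x → a x ≢ x) (b≢ : ∀ x → b x ≢ x) where

    -- a rotateᵏ is conjugate to a or to b, according to the parity of k.
    no-reflection : ∀ k x → a (iter rotate x k) ≢ x
    no-reflection zero          x eq = a≢ x eq
    no-reflection (suc zero)    x eq = b≢ (a x) (trans (sym (aa _)) (cong a eq))
    no-reflection (suc (suc k)) x eq = no-reflection k (rotate x)
      (begin
        a (iter rotate (rotate x) k)             ≡⟨ bb _ ⟨
        b (rotate (iter rotate (rotate x) k))    ≡⟨ cong b (iter-suc rotate (rotate x) k) ⟨
        b (iter rotate x (2 + k))                ≡⟨ cong b (aa _) ⟨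
        b (a (a (iter rotate x (2 + k))))        ≡⟨ cong (b ∘ a) eq ⟩
        b (a x)                                  ∎)
      where open ≡-Reasoning

    -- Cancelling the smaller number of rotations leaves a reflection with a fixed point. On the
    -- tour this separates the flags at which ends are entered from those at which they are left.
    no-crossing : ∀ x i j → iter rotate x i ≢ a (iter rotate x j)
    no-crossing x i j eq with ℕ.≤-total i j
    ... | inj₁ i≤j = no-reflection (j ∸ i) (iter rotate x i) (trans (cong a
          (trans (sym (iter-+ rotate x i (j ∸ i))) (cong (iter rotate x) (ℕ.m+[n∸m]≡n i≤j)))) (sym eq))
    ... | inj₂ j≤i = no-reflection (i ∸ j) (iter rotate x j) (trans (cong a
          (trans (sym (iter-+ rotate x j (i ∸ j))) (trans (cong (iter rotate x) (ℕ.m+[n∸m]≡n j≤i)) eq))) (aa _))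

    iterᵇ : X → ℕ → Bool → X
    iterᵇ x j false = iter rotate x j
    iterᵇ x j true  = a (iter rotate x j)

    iterᵇ-injective : ∀ x i j s t → iterᵇ x i s ≡ iterᵇ x j t → iter rotate x i ≡ iter rotate x j × s ≡ t
    iterᵇ-injective x i j false false eq = eq , refl
    iterᵇ-injective x i j false true  eq = contradiction eq (no-crossing x i j)
    iterᵇ-injective x i j true  false eq = contradiction (sym eq) (no-crossing x j i)
    iterᵇ-injective x i j true  true  eq = involutive⇒injective a aa eq , refl

    module _ {M} (X↔Fin : X ↔ Fin M) where

      private
        point : X → ∀ L → Fin (L * 2) → X
        point x L k = iterᵇ x (toℕ (proj₁ (halve L k))) (proj₂ (halve L k))

        shorter : ∀ x {i j L} → i < j → j < L → iter rotate x i ≡ iter rotate x j →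
                  ∃ λ q → suc q < L × iter rotate x (suc q) ≡ x
        shorter x {i} {j} i<j j<L eq with j ∸ i | ℕ.m∸n≤m j i | iter-∸ x (ℕ.<⇒≤ i<j) eq | ℕ.m<n⇒0<n∸m i<j
        ... | suc q | q<j | p | _ = q , ℕ.≤-<-trans q<j j<L , p

        collision : ∀ x L (k l : Fin (L * 2)) → k ≢ l → point x L k ≡ point x L l →
                    ∃ λ q → suc q < L × iter rotate x (suc q) ≡ x
        collision x L k l k≢l eq
          with iterᵇ-injective x (toℕ (proj₁ (halve L k))) (toℕ (proj₁ (halve L l)))
                 (proj₂ (halve L k)) (proj₂ (halve L l)) eq
        ... | eq₁ , eq₂ with ℕ.<-cmp (toℕ (proj₁ (halve L k))) (toℕ (proj₁ (halve L l)))
        ...   | tri< i<j _ _ = shorter x i<j (Fin.toℕ<n (proj₁ (halve L l))) eq₁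
        ...   | tri> _ _ j<i = shorter x j<i (Fin.toℕ<n (proj₁ (halve L k))) (sym eq₁)
        ...   | tri≈ _ i≡j _ = contradiction (↔-injective (half↔ {L}) (cong₂ _,_ (Fin.toℕ-injective i≡j) eq₂)) k≢l

      opaque
        -- Pigeonhole on the 2L points `iterᵇ x j s` with j < L. By `no-crossing` a collision has
        -- equal bits, hence comes from two different powers of `rotate`. Including the reflected
        -- points halves the bound on the period.
        ∃-period : ∀ x L → M < L * 2 → ∃ λ q → suc q < L × iter rotate x (suc q) ≡ x
        ∃-period x L M<2L with Fin.pigeonhole M<2L (Inverse.to X↔Fin ∘ point x L)
        ... | k , l , k<l , eq = collision x L k l (Fin.<⇒≢ k<l) (↔-injective X↔Fin eq)

      opaque
        -- If the orbit is everything, `onCycle` gives each element coordinates among 2 (q + 1)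
        -- possibilities. Together with `∃-period` this fixes the period for a bouquet.
        transitive⇒≤period : ∀ {q x} → (∀ y → Orbit a b x y) → iter rotate x (suc q) ≡ x → M ≤ suc q * 2
        transitive⇒≤period {q} {x} all period = Fin.injective⇒≤ {f = code} code-injective
          where
          coords : ∀ y → ∃ λ (js : Fin (suc q) × Bool) → y ≡ iterᵇ x (toℕ (proj₁ js)) (proj₂ js)
          coords y with onCycle period (all y)
          ... | j , j<q , inj₁ eq = (fromℕ< j<q , false) , trans eq (cong (iter rotate x) (sym (Fin.toℕ-fromℕ< j<q)))
          ... | j , j<q , inj₂ eq = (fromℕ< j<q , true)  , trans eq (cong (a ∘ iter rotate x) (sym (Fin.toℕ-fromℕ< j<q)))
          code : Fin M → Fin (suc q * 2)
          code k = Inverse.from half↔ (proj₁ (coords (Inverse.from X↔Fin k)))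
          code-injective : Injective _≡_ _≡_ code
          code-injective {k} {l} eq = ↔-injective (↔-sym X↔Fin)
            (trans (proj₂ (coords (Inverse.from X↔Fin k)))
              (trans (cong (λ js → iterᵇ x (toℕ (proj₁ js)) (proj₂ js))
                  (↔-injective (↔-sym (half↔ {suc q}))
                    {proj₁ (coords (Inverse.from X↔Fin k))} {proj₁ (coords (Inverse.from X↔Fin l))} eq))
                (sym (proj₂ (coords (Inverse.from X↔Fin l))))))

-- Counting curves by their 2-colourings

record Invariant {n} (a b : Flag n → Flag n) : Set where
  field
    colour : Flag n → Bool
    invᵃ   : ∀ y → colour (a y) ≡ colour y
    invᵇ   : ∀ y → colour (b y) ≡ colour y
open Invariant public

-- Equality compares only the colours, pointwise; the invariance proofs are ignored. `Ker` below
-- follows the same pattern.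
Colourings : (a b : Flag n → Flag n) → Setoid 0ℓ 0ℓ
Colourings {n} a b = On.setoid {B = Invariant a b} (Flag n →-setoid Bool) colour

Cube : ℕ → Setoid 0ℓ 0ℓ
Cube k = Fin k →-setoid Bool

module Curves {n} (a b : Flag n → Flag n)
  (aa : ∀ x → a (a x) ≡ x) (bb : ∀ x → b (b x) ≡ x)
  (a≢ : ∀ x → a x ≢ x) (b≢ : ∀ x → b x ≢ x) where

  open Involutions a b aa bb

  trace⇒Orbit : ∀ {a b : Flag n → Flag n} k {x y} → y ∈ trace a b k x → Orbit a b x y
  trace⇒Orbit (suc k) (here refl) = start
  trace⇒Orbit (suc k) (there y∈) = Orbit-trans (stepᵃ start) (Orbit-swap (trace⇒Orbit k y∈))

  iter∈trace : ∀ j k x → suc (suc (j * 2)) ≤ k → iter rotate x j ∈ trace a b k x × a (iter rotate x j) ∈ trace a b k x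
  iter∈trace zero    (suc (suc k)) x (s≤s (s≤s _)) = here refl , there (here refl)
  iter∈trace (suc j) (suc (suc k)) x (s≤s (s≤s p)) with iter∈trace j k (rotate x) p
  ... | q , r = there (there q) , there (there r)

  sameCurve⇒Orbit : ∀ {x y} → SameCurve a b x y → Orbit a b x y
  sameCurve⇒Orbit = trace⇒Orbit (4 * n)

  -- Since there are 4n flags, `∃-period` with L = 2n + 1 yields a period of at most 2n. Each
  -- rotation uses two entries of the trace, so 4n entries reach the whole orbit.
  Orbit⇒sameCurve : ∀ {x y} → Orbit a b x y → SameCurve a b x y
  Orbit⇒sameCurve {x} o with ∃-period a≢ b≢ flag↔Fin x (suc (n * 2))
      (subst (_< suc (n * 2) * 2) (ℕ.*-assoc n 2 2) (ℕ.m<n⇒m<1+n (ℕ.n<1+n _)))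
  ... | q , s≤s q<2n , period with onCycle period o
  ...   | j , j<q , y≡ = helper y≡
    where
    bound : suc j * 2 ≤ 4 * n
    bound = subst (suc j * 2 ≤_) (trans (ℕ.*-assoc n 2 2) (ℕ.*-comm n 4)) (ℕ.*-monoˡ-≤ 2 (ℕ.≤-trans j<q q<2n))
    helper : ∀ {y} → y ≡ iter rotate x j ⊎ y ≡ a (iter rotate x j) → SameCurve a b x y
    helper (inj₁ refl) = proj₁ (iter∈trace j (4 * n) x bound)
    helper (inj₂ refl) = proj₂ (iter∈trace j (4 * n) x bound)

  curves : DecSetoid 0ℓ 0ℓ
  curves = record
    { _≈_ = SameCurve a b
    ; isDecEquivalence = record
      { isEquivalence = record
        { refl  = Orbit⇒sameCurve start
        ; sym   = Orbit⇒sameCurve ∘ Orbit-sym ∘ sameCurve⇒Orbit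
        ; trans = λ p q → Orbit⇒sameCurve (Orbit-trans (sameCurve⇒Orbit p) (sameCurve⇒Orbit q))
        }
      ; _≟_ = sameCurve? a b
      }
    }
  open DecSetoid curves using () renaming (sym to ~-sym; trans to ~-trans)

  representatives : List (Flag n)
  representatives = deduplicate (sameCurve? a b) (flags n)

  representative : ∀ y → Any (SameCurve a b y) representatives
  representative y = Any-deduplicate⁺ (sameCurve? a b) (λ z~w y~z → ~-trans y~z (~-sym z~w))
    (Any.map (λ {refl → Orbit⇒sameCurve start}) (∈-flags y))

  lookup-injective : ∀ {xs} → Setoid.Unique (DecSetoid.setoid curves) xs →
                     ∀ i j → SameCurve a b (List.lookup xs i) (List.lookup xs j) → i ≡ j
  lookup-injective (x∉ ∷ u) Fin.zero    Fin.zero    p = refl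
  lookup-injective {x ∷ xs} (x∉ ∷ u) Fin.zero    (Fin.suc j) p = contradiction p (All.lookup x∉ (∈-lookup j))
  lookup-injective {x ∷ xs} (x∉ ∷ u) (Fin.suc i) Fin.zero    p = contradiction (~-sym p) (All.lookup x∉ (∈-lookup i))
  lookup-injective (x∉ ∷ u) (Fin.suc i) (Fin.suc j) p = cong Fin.suc (lookup-injective u i j p)

  invariant-Orbit : (c : Invariant a b) → ∀ {x y} → Orbit a b x y → colour c y ≡ colour c x
  invariant-Orbit c start     = refl
  invariant-Orbit c (stepᵃ o) = trans (invᵃ c _) (invariant-Orbit c o)
  invariant-Orbit c (stepᵇ o) = trans (invᵇ c _) (invariant-Orbit c o)

  curveOf : Flag n → Fin (#curves a b)
  curveOf y = index (representative y)

  curveOf~ : ∀ y → SameCurve a b y (List.lookup representatives (curveOf y))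
  curveOf~ y = lookup-index (representative y)

  curveOf-unique : ∀ {y} i → SameCurve a b y (List.lookup representatives i) → curveOf y ≡ i
  curveOf-unique {y} i p = lookup-injective (DecUnique.deduplicate-! curves (flags n)) (curveOf y) i
    (~-trans (~-sym (curveOf~ y)) p)

  curveOf-cong : ∀ {y z} → Orbit a b y z → curveOf z ≡ curveOf y
  curveOf-cong {y} {z} o = curveOf-unique (curveOf y) (~-trans (~-sym (Orbit⇒sameCurve o)) (curveOf~ y))

  colourings-of-curves : Inverse (Colourings a b) (Cube (#curves a b))
  colourings-of-curves = record
    { to        = λ c i → colour c (List.lookup representatives i)
    ; from      = λ g → record
      { colour = g ∘ curveOf
      ; invᵃ   = λ y → cong g (curveOf-cong (stepᵃ start))
      ; invᵇ   = λ y → cong g (curveOf-cong (stepᵇ start))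
      }
    ; to-cong   = λ eq i → eq (List.lookup representatives i)
    ; from-cong = λ eq y → eq (curveOf y)
    ; inverse   =
        (λ {g} {c} eq i → trans (eq (List.lookup representatives i)) (cong g (curveOf-unique i (Orbit⇒sameCurve start))))
      , (λ {c} {g} eq y → trans (eq (curveOf y)) (invariant-Orbit c (sameCurve⇒Orbit (curveOf~ y))))
    }

  single-curve⇒transitive : #curves a b ≡ 1 → ∀ x y → Orbit a b x y
  single-curve⇒transitive one x y = sameCurve⇒Orbit
    (~-trans (curveOf~ x) (subst (λ i → SameCurve a b (List.lookup representatives i) y)
      (all-equal one (curveOf y) (curveOf x)) (~-sym (curveOf~ y))))
    where
    all-equal : ∀ {k} → k ≡ 1 → (i j : Fin k) → i ≡ j
    all-equal refl Fin.zero Fin.zero = refl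

-- Kernels over GF(2)

punchIn-elim : ∀ (v : Fin (suc n)) (P : Fin (suc n) → Set) → P v → (∀ u → P (punchIn v u)) → ∀ u → P u
punchIn-elim v P pv p u with v Fin.≟ u
... | yes refl = pv
... | no v≢u   = subst P (Fin.punchIn-punchOut v≢u) (p (punchOut v≢u))

negative : Sign → Bool
negative Sign.- = true
negative Sign.+ = false

-- The entry at e of the product M x over GF(2). As `adj` is irreflexive, the diagonal of M is
-- supplied separately by the signs.
row : SignedGraph n → (Fin n → Bool) → Fin n → Bool
row SG x e = (negative (sign SG e) ∧ x e) xor sum (λ f → adj SG e f ∧ x f)

row-cong : ∀ (SG : SignedGraph n) {x y} → x ≗ y → row SG x ≗ row SG y
row-cong SG x≗y e = cong₂ _xor_ (cong (negative (sign SG e) ∧_) (x≗y e)) (sum-cong-≗ (λ f → cong (adj SG e f ∧_) (x≗y f)))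

sum-zero : ∀ {n} {x : Fin n → Bool} → (∀ i → x i ≡ false) → sum x ≡ false
sum-zero {n} x≗0 = trans (sum-cong-≗ x≗0) (sum-replicate-zero n)

row-punchIn : ∀ (SG : SignedGraph (suc n)) v x u →
  row SG x (punchIn v u) ≡ (adj SG (punchIn v u) v ∧ x v) xor row (SG - v) (x ∘ punchIn v) u
row-punchIn SG v x u = trans
  (cong ((negative (sign SG (punchIn v u)) ∧ x (punchIn v u)) xor_)
    (sum-remove {i = v} (λ f → adj SG (punchIn v u) f ∧ x f)))
  (xor-swap (negative (sign SG (punchIn v u)) ∧ x (punchIn v u)) (adj SG (punchIn v u) v ∧ x v)
    (sum (λ f → adj SG (punchIn v u) (punchIn v f) ∧ x (punchIn v f))))
  where
  xor-swap : ∀ a b c → a xor (b xor c) ≡ b xor (a xor c)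
  xor-swap false b     c = refl
  xor-swap true  false c = refl
  xor-swap true  true  c = refl

row-positive : ∀ (SG : SignedGraph (suc n)) v x → sign SG v ≡ Sign.+ →
  row SG x v ≡ sum (λ u → adj SG v (punchIn v u) ∧ x (punchIn v u))
row-positive SG v x v+ rewrite v+ = trans (sum-remove {i = v} (λ f → adj SG v f ∧ x f))
  (cong (_xor sum (λ u → adj SG v (punchIn v u) ∧ x (punchIn v u))) (cong (_∧ x v) (adj-irrefl SG v)))

-- The kernel of the principal submatrix M[A], with its vectors extended by zero to all vertices.
-- This avoids matrices indexed by A; rows outside A are left unconstrained.
record Kernel (SG : SignedGraph n) (A : Subset n) : Set where
  field
    vector    : Fin n → Bool
    supported : ∀ e → lookup A e ≡ false → vector e ≡ false
    null      : ∀ e → lookup A e ≡ true → row SG vector e ≡ false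
open Kernel public

Ker : SignedGraph n → Subset n → Setoid 0ℓ 0ℓ
Ker {n} SG A = On.setoid {B = Kernel SG A} (Fin n →-setoid Bool) vector

module _ (SG : SignedGraph (suc n)) (v : Fin (suc n)) where

  private
    in-v : ∀ {x b} {A : Subset n} → lookup (insertAt A v b) v ≡ x → b ≡ x
    in-v {b = b} {A} = trans (sym (Vec.insertAt-lookup A v b))

    in-u : ∀ {x b} {A : Subset n} u → lookup (insertAt A v b) (punchIn v u) ≡ x → lookup A u ≡ x
    in-u {b = b} {A} u = trans (sym (Vec.insertAt-punchIn A v b u))

  -- The hypothesis makes column v contribute nothing to the rows in A. It is met in two ways: the
  -- coordinate at v vanishes, or v has no neighbour in A.
  restrict : ∀ {A b} (x : Kernel SG (insertAt A v b)) →
             (∀ u → lookup A u ≡ true → adj SG (punchIn v u) v ∧ vector x v ≡ false) → Kernel (SG - v) A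
  restrict {A} {b} x v-null = record
    { vector    = vector x ∘ punchIn v
    ; supported = λ u u∉A → supported x (punchIn v u) (trans (Vec.insertAt-punchIn A v b u) u∉A)
    ; null      = λ u u∈A → begin
        row (SG - v) (vector x ∘ punchIn v) u
          ≡⟨ cong (_xor row (SG - v) (vector x ∘ punchIn v) u) (v-null u u∈A) ⟨
        (adj SG (punchIn v u) v ∧ vector x v) xor row (SG - v) (vector x ∘ punchIn v) u
          ≡⟨ row-punchIn SG v (vector x) u ⟨
        row SG (vector x) (punchIn v u)
          ≡⟨ null x (punchIn v u) (trans (Vec.insertAt-punchIn A v b u) u∈A) ⟩
        false ∎
    }
    where open ≡-Reasoning

  row-insertAt : ∀ x c u → row SG (F.insertAt x v c) (punchIn v u) ≡ (adj SG (punchIn v u) v ∧ c) xor row (SG - v) x u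
  row-insertAt x c u = trans (row-punchIn SG v (F.insertAt x v c) u)
    (cong₂ (λ b c → (adj SG (punchIn v u) v ∧ b) xor c)
      (F.insertAt-lookup x v c) (row-cong (SG - v) (F.insertAt-punchIn x v c) u))

  extend : ∀ {A b} (x : Fin n → Bool) (c : Bool) →
           (∀ u → lookup A u ≡ false → x u ≡ false) →
           (b ≡ false → c ≡ false) →
           (∀ u → lookup A u ≡ true → (adj SG (punchIn v u) v ∧ c) xor row (SG - v) x u ≡ false) →
           (b ≡ true → row SG (F.insertAt x v c) v ≡ false) →
           Kernel SG (insertAt A v b)
  extend {A} {b} x c supp c-supp rows row-v = record
    { vector    = F.insertAt x v c
    ; supported = punchIn-elim v _
        (λ v∉ → trans (F.insertAt-lookup x v c) (c-supp (in-v v∉)))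
        (λ u u∉ → trans (F.insertAt-punchIn x v c u) (supp u (in-u u u∉)))
    ; null      = punchIn-elim v _
        (λ v∈ → row-v (in-v v∈))
        (λ u u∈ → trans (row-insertAt x c u) (rows u (in-u u u∈)))
    }

  -- A principal submatrix that omits v contains neither the row nor the column of v.
  Ker-delete : ∀ A → Inverse (Ker SG (insertAt A v false)) (Ker (SG - v) A)
  Ker-delete A = record
    { to        = λ x → restrict x (λ u _ → trans (cong (adj SG (punchIn v u) v ∧_) (at-v x)) (∧-zeroʳ _))
    ; from      = λ x → extend (vector x) false (supported x) (λ _ → refl)
        (λ u u∈ → trans (cong (_xor row (SG - v) (vector x) u) (∧-zeroʳ (adj SG (punchIn v u) v))) (null x u u∈)) λ ()
    ; to-cong   = λ eq u → eq (punchIn v u)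
    ; from-cong = λ {x} {y} eq → punchIn-elim v _
        (trans (F.insertAt-lookup (vector x) v false) (sym (F.insertAt-lookup (vector y) v false)))
        (λ u → trans (F.insertAt-punchIn (vector x) v false u) (trans (eq u) (sym (F.insertAt-punchIn (vector y) v false u))))
    ; inverse   =
        (λ {x} eq u → trans (eq (punchIn v u)) (F.insertAt-punchIn (vector x) v false u))
      , (λ {x} {y} eq → punchIn-elim v _
          (trans (F.insertAt-lookup (vector y) v false) (sym (at-v x)))
          (λ u → trans (F.insertAt-punchIn (vector y) v false u) (eq u)))
    }
    where
    at-v : (x : Kernel SG (insertAt A v false)) → vector x v ≡ false
    at-v x = supported x v (Vec.insertAt-lookup A v false)

  module _ (v+ : sign SG v ≡ Sign.+) where

    row-insertAt-self : ∀ x c → row SG (F.insertAt x v c) v ≡ sum (λ u → adj SG v (punchIn v u) ∧ x u)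
    row-insertAt-self x c = trans (row-positive SG v (F.insertAt x v c) v+)
      (sum-cong-≗ (λ u → cong (adj SG v (punchIn v u) ∧_) (F.insertAt-punchIn x v c u)))

    -- The diagonal entry at the positive vertex v is 0 and v has no neighbour in A, so row and
    -- column v of the submatrix vanish and the coordinate at v is free.
    Ker-isolated : ∀ A → (∀ u → lookup A u ≡ true → adj SG v (punchIn v u) ≡ false) →
                   Inverse (Ker SG (insertAt A v true)) (×-setoid (setoid Bool) (Ker (SG - v) A))
    Ker-isolated A isolated = record
      { to        = λ x → vector x v , restrict x (λ u u∈ → cong (_∧ vector x v) (isolated′ u u∈))
      ; from      = λ (c , x) → extend (vector x) c (supported x) (λ ())
          (λ u u∈ → trans (cong (λ b → (b ∧ c) xor row (SG - v) (vector x) u) (isolated′ u u∈)) (null x u u∈))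
          (λ _ → trans (row-insertAt-self (vector x) c) (sum-zero (λ u → term x u)))
      ; to-cong   = λ eq → eq v , λ u → eq (punchIn v u)
      ; from-cong = λ {(c , x)} {(d , y)} (eq , eqs) → punchIn-elim v _
          (trans (F.insertAt-lookup (vector x) v c) (trans eq (sym (F.insertAt-lookup (vector y) v d))))
          (λ u → trans (F.insertAt-punchIn (vector x) v c u) (trans (eqs u) (sym (F.insertAt-punchIn (vector y) v d u))))
      ; inverse   =
          (λ {(c , x)} eq → trans (eq v) (F.insertAt-lookup (vector x) v c) ,
             λ u → trans (eq (punchIn v u)) (F.insertAt-punchIn (vector x) v c u))
        , (λ {x} {(c , y)} (eq , eqs) → punchIn-elim v _
            (trans (F.insertAt-lookup (vector y) v c) eq)
            (λ u → trans (F.insertAt-punchIn (vector y) v c u) (eqs u)))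
      }
      where
      isolated′ : ∀ u → lookup A u ≡ true → adj SG (punchIn v u) v ≡ false
      isolated′ u u∈ = trans (adj-sym SG (punchIn v u) v) (isolated u u∈)
      term : (x : Kernel (SG - v) A) → ∀ u → adj SG v (punchIn v u) ∧ vector x u ≡ false
      term x u with lookup A u in eq
      ... | true  = cong (_∧ vector x u) (isolated u eq)
      ... | false = trans (cong (adj SG v (punchIn v u) ∧_) (supported x u eq)) (∧-zeroʳ _)

module _ (SG : SignedGraph (suc (suc n))) (v : Fin (suc (suc n))) (w : Fin (suc n))
  (v+ : sign SG v ≡ Sign.+) (vw : adj SG v (punchIn v w) ≡ true)
  (leaf : ∀ u → adj SG v (punchIn v (punchIn w u)) ≡ false) where

  private
    row-leaf : ∀ (x : Fin (suc n) → Bool) → sum (λ u → adj SG v (punchIn v u) ∧ x u) ≡ x w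
    row-leaf x = begin
      sum (λ u → adj SG v (punchIn v u) ∧ x u)
        ≡⟨ sum-remove {i = w} (λ u → adj SG v (punchIn v u) ∧ x u) ⟩
      (adj SG v (punchIn v w) ∧ x w) xor sum (λ u → adj SG v (punchIn v (punchIn w u)) ∧ x (punchIn w u))
        ≡⟨ cong₂ (λ a b → (a ∧ x w) xor b) vw (sum-zero (λ u → cong (_∧ x (punchIn w u)) (leaf u))) ⟩
      x w xor false ≡⟨ xor-identityʳ (x w) ⟩
      x w ∎
      where open ≡-Reasoning

    xor≡false⇒≡ : ∀ {a b} → a xor b ≡ false → a ≡ b
    xor≡false⇒≡ {false} {false} _ = refl
    xor≡false⇒≡ {true}  {true}  _ = refl

    SG₁  = SG - v
    SG₁₂ = SG - v - w

    vw′ : adj SG (punchIn v w) v ≡ true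
    vw′ = trans (adj-sym SG _ _) vw

    leaf′ : ∀ u → adj SG (punchIn v (punchIn w u)) v ≡ false
    leaf′ u = trans (adj-sym SG _ _) (leaf u)

  -- Row v forces the coordinate of w to vanish, and row w then determines
  -- the coordinate of v.
  Ker-leaf : ∀ A → Inverse (Ker SG (insertAt (insertAt A w true) v true)) (Ker SG₁₂ A)
  Ker-leaf A = record
    { to        = to
    ; from      = from
    ; to-cong   = λ eq u → eq (punchIn v (punchIn w u))
    ; from-cong = λ {x} {y} eq → punchIn-elim v _
        (trans (F.insertAt-lookup (inner x) v (outer x))
          (trans (row-cong SG₁ (inner-cong {x} {y} eq) w) (sym (F.insertAt-lookup (inner y) v (outer y)))))
        (λ u → trans (F.insertAt-punchIn (inner x) v (outer x) u)
          (trans (inner-cong {x} {y} eq u) (sym (F.insertAt-punchIn (inner y) v (outer y) u))))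
    ; inverse   =
        (λ {x} eq u → trans (eq (punchIn v (punchIn w u)))
          (trans (F.insertAt-punchIn (inner x) v (outer x) (punchIn w u)) (F.insertAt-punchIn (vector x) w false u)))
      , (λ {x} {y} eq → punchIn-elim v _
          (trans (F.insertAt-lookup (inner y) v (outer y)) (trans (row-cong SG₁ (inner-restrict x y eq) w) (sym (at-v x))))
          (λ u → trans (F.insertAt-punchIn (inner y) v (outer y) u) (inner-restrict x y eq u)))
    }
    where
    open ≡-Reasoning

    ∈A : ∀ {u b} → lookup A u ≡ b → lookup (insertAt (insertAt A w true) v true) (punchIn v (punchIn w u)) ≡ b
    ∈A {u} = trans (trans (Vec.insertAt-punchIn (insertAt A w true) v true (punchIn w u)) (Vec.insertAt-punchIn A w true u))

    w∈ : lookup (insertAt (insertAt A w true) v true) (punchIn v w) ≡ true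
    w∈ = trans (Vec.insertAt-punchIn (insertAt A w true) v true w) (Vec.insertAt-lookup A w true)

    inner : Kernel SG₁₂ A → Fin (suc n) → Bool
    inner x = F.insertAt (vector x) w false

    outer : Kernel SG₁₂ A → Bool
    outer x = row SG₁ (inner x) w

    inner-cong : ∀ {x y} → vector x ≗ vector y → inner x ≗ inner y
    inner-cong {x} {y} eq = punchIn-elim w _
      (trans (F.insertAt-lookup (vector x) w false) (sym (F.insertAt-lookup (vector y) w false)))
      (λ u → trans (F.insertAt-punchIn (vector x) w false u) (trans (eq u) (sym (F.insertAt-punchIn (vector y) w false u))))

    at-w : (x : Kernel SG (insertAt (insertAt A w true) v true)) → vector x (punchIn v w) ≡ false
    at-w x = begin
      vector x (punchIn v w)                                          ≡⟨ row-leaf (vector x ∘ punchIn v) ⟨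
      sum (λ u → adj SG v (punchIn v u) ∧ vector x (punchIn v u))     ≡⟨ row-positive SG v (vector x) v+ ⟨
      row SG (vector x) v                                             ≡⟨ null x v (Vec.insertAt-lookup (insertAt A w true) v true) ⟩
      false                                                           ∎

    at-v : (x : Kernel SG (insertAt (insertAt A w true) v true)) → vector x v ≡ row SG₁ (vector x ∘ punchIn v) w
    at-v x = xor≡false⇒≡ (begin
      vector x v xor row SG₁ (vector x ∘ punchIn v) w
        ≡⟨ cong (λ b → (b ∧ vector x v) xor row SG₁ (vector x ∘ punchIn v) w) vw′ ⟨
      (adj SG (punchIn v w) v ∧ vector x v) xor row SG₁ (vector x ∘ punchIn v) w
        ≡⟨ row-punchIn SG v (vector x) w ⟨
      row SG (vector x) (punchIn v w)
        ≡⟨ null x (punchIn v w) w∈ ⟩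
      false ∎)

    inner-restrict : ∀ (x : Kernel SG (insertAt (insertAt A w true) v true)) (y : Kernel SG₁₂ A) →
                     vector y ≗ vector x ∘ punchIn v ∘ punchIn w → inner y ≗ vector x ∘ punchIn v
    inner-restrict x y eq = punchIn-elim w _
      (trans (F.insertAt-lookup (vector y) w false) (sym (at-w x)))
      (λ u → trans (F.insertAt-punchIn (vector y) w false u) (eq u))

    to : Kernel SG (insertAt (insertAt A w true) v true) → Kernel SG₁₂ A
    to x = record
      { vector    = vector x ∘ punchIn v ∘ punchIn w
      ; supported = λ u u∉ → supported x _ (∈A u∉)
      ; null      = λ u u∈ → begin
          row SG₁₂ (vector x ∘ punchIn v ∘ punchIn w) u
            ≡⟨ cong (_xor row SG₁₂ (vector x ∘ punchIn v ∘ punchIn w) u) (∧-zeroʳ (adj SG₁ (punchIn w u) w)) ⟨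
          (adj SG₁ (punchIn w u) w ∧ false) xor row SG₁₂ (vector x ∘ punchIn v ∘ punchIn w) u
            ≡⟨ cong (λ b → (adj SG₁ (punchIn w u) w ∧ b) xor row SG₁₂ (vector x ∘ punchIn v ∘ punchIn w) u) (at-w x) ⟨
          (adj SG₁ (punchIn w u) w ∧ vector x (punchIn v w)) xor row SG₁₂ (vector x ∘ punchIn v ∘ punchIn w) u
            ≡⟨ row-punchIn SG₁ w (vector x ∘ punchIn v) u ⟨
          row SG₁ (vector x ∘ punchIn v) (punchIn w u)
            ≡⟨ cong (λ b → (b ∧ vector x v) xor row SG₁ (vector x ∘ punchIn v) (punchIn w u)) (leaf′ u) ⟨
          (adj SG (punchIn v (punchIn w u)) v ∧ vector x v) xor row SG₁ (vector x ∘ punchIn v) (punchIn w u)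
            ≡⟨ row-punchIn SG v (vector x) (punchIn w u) ⟨
          row SG (vector x) (punchIn v (punchIn w u))
            ≡⟨ null x _ (∈A u∈) ⟩
          false ∎
      }

    from : Kernel SG₁₂ A → Kernel SG (insertAt (insertAt A w true) v true)
    from x = extend SG v (inner x) (outer x)
      (punchIn-elim w _
        (λ _ → F.insertAt-lookup (vector x) w false)
        (λ u u∉ → trans (F.insertAt-punchIn (vector x) w false u) (supported x u (trans (sym (Vec.insertAt-punchIn A w true u)) u∉))))
      (λ ())
      (punchIn-elim w _
        (λ _ → trans (cong (λ b → (b ∧ outer x) xor outer x) vw′) (xor-same (outer x)))
        (λ u u∈ → begin
          (adj SG (punchIn v (punchIn w u)) v ∧ outer x) xor row SG₁ (inner x) (punchIn w u)
            ≡⟨ cong (λ b → (b ∧ outer x) xor row SG₁ (inner x) (punchIn w u)) (leaf′ u) ⟩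
          row SG₁ (inner x) (punchIn w u)
            ≡⟨ row-insertAt SG₁ w (vector x) false u ⟩
          (adj SG₁ (punchIn w u) w ∧ false) xor row SG₁₂ (vector x) u
            ≡⟨ cong (_xor row SG₁₂ (vector x) u) (∧-zeroʳ (adj SG₁ (punchIn w u) w)) ⟩
          row SG₁₂ (vector x) u
            ≡⟨ null x u (trans (sym (Vec.insertAt-punchIn A w true u)) u∈) ⟩
          false ∎))
      (λ _ → trans (row-insertAt-self SG v v+ (inner x) (outer x))
        (trans (row-leaf (inner x)) (F.insertAt-lookup (vector x) w false)))

-- Transport of kernels along isomorphisms

module _ {SG SH : SignedGraph n} (iso : SG ≅ SH) where
  open _≅_ iso renaming (bijection to π)

  -- This is the image of A under π, written as a preimage under the inverse of π.
  reindex : Subset n → Subset n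
  reindex A = tabulate (λ u → lookup A (π ⟨$⟩ˡ u))

  row-≅ : ∀ x u → row SG (x ∘ (π ⟨$⟩ʳ_)) u ≡ row SH x (π ⟨$⟩ʳ u)
  row-≅ x u = cong₂ _xor_ (cong (λ s → negative s ∧ x (π ⟨$⟩ʳ u)) (sign-≡ u))
    (trans (sum-cong-≗ (λ f → cong (_∧ x (π ⟨$⟩ʳ f)) (adj-≡ u f)))
      (sym (sum-permute (λ f → adj SH (π ⟨$⟩ʳ u) f ∧ x f) π)))

  Ker-≅ : ∀ A → Inverse (Ker SH (reindex A)) (Ker SG A)
  Ker-≅ A = record
    { to        = λ x → record
      { vector    = vector x ∘ (π ⟨$⟩ʳ_)
      ; supported = λ e e∉ → supported x (π ⟨$⟩ʳ e) (trans (reindex-ʳ e) e∉)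
      ; null      = λ e e∈ → trans (row-≅ (vector x) e) (null x _ (trans (reindex-ʳ e) e∈))
      }
    ; from      = λ x → record
      { vector    = vector x ∘ (π ⟨$⟩ˡ_)
      ; supported = λ e e∉ → supported x _ (trans (sym (reindex-ˡ e)) e∉)
      ; null      = λ e e∈ → begin
          row SH (vector x ∘ (π ⟨$⟩ˡ_)) e
            ≡⟨ cong (row SH (vector x ∘ (π ⟨$⟩ˡ_))) (Perm.inverseʳ π) ⟨
          row SH (vector x ∘ (π ⟨$⟩ˡ_)) (π ⟨$⟩ʳ (π ⟨$⟩ˡ e))
            ≡⟨ row-≅ (vector x ∘ (π ⟨$⟩ˡ_)) (π ⟨$⟩ˡ e) ⟨
          row SG (vector x ∘ (π ⟨$⟩ˡ_) ∘ (π ⟨$⟩ʳ_)) (π ⟨$⟩ˡ e)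
            ≡⟨ row-cong SG (λ f → cong (vector x) (Perm.inverseˡ π)) (π ⟨$⟩ˡ e) ⟩
          row SG (vector x) (π ⟨$⟩ˡ e)
            ≡⟨ null x _ (trans (sym (reindex-ˡ e)) e∈) ⟩
          false ∎
      }
    ; to-cong   = λ eq u → eq (π ⟨$⟩ʳ u)
    ; from-cong = λ eq u → eq (π ⟨$⟩ˡ u)
    ; inverse   =
        (λ {x} eq u → trans (eq (π ⟨$⟩ʳ u)) (cong (vector x) (Perm.inverseˡ π)))
      , (λ {x} eq u → trans (eq (π ⟨$⟩ˡ u)) (cong (vector x) (Perm.inverseʳ π)))
    }
    where
    open ≡-Reasoning
    reindex-ˡ : ∀ e → lookup (reindex A) e ≡ lookup A (π ⟨$⟩ˡ e)
    reindex-ˡ e = Vec.lookup∘tabulate _ e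
    reindex-ʳ : ∀ e → lookup (reindex A) (π ⟨$⟩ʳ e) ≡ lookup A e
    reindex-ʳ e = trans (reindex-ˡ (π ⟨$⟩ʳ e)) (cong (lookup A) (Perm.inverseˡ π))

-- Coranks as exponents of powers of two

×Bool : ∀ {S T : Setoid 0ℓ 0ℓ} → Inverse S T → Inverse (×-setoid (setoid Bool) S) (×-setoid (setoid Bool) T)
×Bool f = idᴵ (setoid Bool) ×-inverse f

Bool×Cube : ∀ k → Inverse (×-setoid (setoid Bool) (Cube k)) (Cube (suc k))
Bool×Cube k = record
  { to        = λ (b , g) → b F.∷ g
  ; from      = λ g → F.head g , F.tail g
  ; to-cong   = λ { (eq , eqs) zero → eq ; (eq , eqs) (suc i) → eqs i }
  ; from-cong = λ eq → eq zero , λ i → eq (suc i)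
  ; inverse   = (λ { eq zero → proj₁ eq ; eq (suc i) → proj₂ eq i }) , (λ eq → eq zero , λ i → eq (suc i))
  }

-- If l < k, then 2^k codes would inject into the fewer 2^l codes. Each code is decoded to one
-- canonical function, so injectivity up to pointwise equality is enough.
cube-injection⇒≤ : ∀ {k l} (f : (Fin k → Bool) → (Fin l → Bool)) →
  (∀ {g h} → f g ≗ f h → g ≗ h) → k ≤ l
cube-injection⇒≤ {k} {l} f inj with k ℕ.≤? l
... | yes k≤l = k≤l
... | no k≰l  = contradiction (ℕ.^-monoʳ-< 2 (s≤s (s≤s z≤n)) (ℕ.≰⇒> k≰l)) (ℕ.≤⇒≯ (Fin.injective⇒≤ code-injective))
  where
  open Inverse Fin.2↔Bool using (inverseˡ; inverseʳ) renaming (to to bit; from to unbit)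
  code : Fin (2 ℕ.^ k) → Fin (2 ℕ.^ l)
  code i = Fin.funToFin (unbit ∘ f (bit ∘ Fin.finToFun i))
  bit-injective : Injective _≡_ _≡_ bit
  bit-injective eq = trans (sym (inverseʳ refl)) (trans (cong unbit eq) (inverseʳ refl))
  unbit-injective : Injective _≡_ _≡_ unbit
  unbit-injective eq = trans (sym (inverseˡ refl)) (trans (cong bit eq) (inverseˡ refl))
  funToFin-injective : ∀ {m n} {g h : Fin m → Fin n} → Fin.funToFin g ≡ Fin.funToFin h → g ≗ h
  funToFin-injective {g = g} {h} eq i =
    trans (sym (Fin.finToFun-funToFin g i)) (trans (cong (λ j → Fin.finToFun j i) eq) (Fin.finToFun-funToFin h i))
  funToFin-cong : ∀ {m n} {g h : Fin m → Fin n} → g ≗ h → Fin.funToFin g ≡ Fin.funToFin h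
  funToFin-cong {zero}  eq = refl
  funToFin-cong {suc m} eq = cong₂ Fin.combine (eq zero) (funToFin-cong (eq ∘ suc))
  code-injective : Injective _≡_ _≡_ code
  code-injective {i} {j} eq = trans (sym (Fin.funToFin-finToFin {k} {2} i)) (trans
    (funToFin-cong (λ m → bit-injective (inj (λ m → unbit-injective (funToFin-injective eq m)) m)))
    (Fin.funToFin-finToFin {k} {2} j))

Cube-injective : ∀ {k l} → Inverse (Cube k) (Cube l) → k ≡ l
Cube-injective f = ℕ.≤-antisym
  (cube-injection⇒≤ (Inverse.to f) (λ {g} {h} eq → inj f {g} {h} eq))
  (cube-injection⇒≤ (Inverse.from f) (λ {g} {h} eq → inj (symᴵ f) {g} {h} eq))
  where
  inj : ∀ {k l} (f : Inverse (Cube k) (Cube l)) → ∀ {g h} → Inverse.to f g ≗ Inverse.to f h → g ≗ h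
  inj {k} {l} f {g} {h} eq = Setoid.trans (Cube k)
    (Setoid.sym (Cube k) (Inverse.inverseʳ f {g} (Setoid.refl (Cube l))))
    (Inverse.inverseʳ f {h} {Inverse.to f g} eq)

-- 2 ^ v = 2 · ∣ Ker SG A ∣, so that v is one more than the corank over GF(2).
Corank : SignedGraph n → Subset n → ℕ → Set
Corank SG A v = Inverse (×-setoid (setoid Bool) (Ker SG A)) (Cube v)

Corank-unique : ∀ {m} {SG : SignedGraph m} {SH : SignedGraph n} {A B v w} →
  Inverse (Ker SG A) (Ker SH B) → Corank SG A v → Corank SH B w → v ≡ w
Corank-unique f p q = Cube-injective (symᴵ p ∘ᴵ (×Bool f ∘ᴵ q))

-- A free bit in the kernel is one more dimension of the cube.
Corank-suc : ∀ {m} {SG : SignedGraph m} {SH : SignedGraph n} {A B v w} →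
  Inverse (Ker SG A) (×-setoid (setoid Bool) (Ker SH B)) → Corank SG A v → Corank SH B w → v ≡ suc w
Corank-suc f p q = Cube-injective (symᴵ p ∘ᴵ (×Bool (f ∘ᴵ q) ∘ᴵ Bool×Cube _))

lookup-∁ : ∀ (A : Subset n) e → lookup (∁ A) e ≡ not (lookup A e)
lookup-∁ A e = Vec.lookup-map e not A

module _ {SG : SignedGraph n} {A v w} (p : Corank SG A v) (q : Corank SG (∁ A) w) where
  private
    module P = Inverse p
    module Q = Inverse q

    left : (Fin (v + w) → Bool) → Fin v → Bool
    left g = g ∘ (_↑ˡ w)

    right : (Fin (v + w) → Bool) → Fin w → Bool
    right g = g ∘ (v ↑ʳ_)

    kerA : (Fin (v + w) → Bool) → Kernel SG A
    kerA g = proj₂ (P.from (left g))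

    ker∁A : (Fin (v + w) → Bool) → Kernel SG (∁ A)
    ker∁A g = proj₂ (Q.from (right g))

    join : (Fin (v + w) → Bool) → Fin (2 + n) → Bool
    join g = proj₁ (P.from (left g)) F.∷ (proj₁ (Q.from (right g)) F.∷ λ e → vector (kerA g) e xor vector (ker∁A g) e)

    separate : ∀ (x y : Kernel SG A) (x′ y′ : Kernel SG (∁ A)) →
      (∀ e → vector x e xor vector x′ e ≡ vector y e xor vector y′ e) →
      vector x ≗ vector y × vector x′ ≗ vector y′
    separate x y x′ y′ eq = proj₁ ∘ both , proj₂ ∘ both
      where
      both : ∀ e → vector x e ≡ vector y e × vector x′ e ≡ vector y′ e
      both e with lookup A e in e∈ | eq e
      ... | false | eqₑ rewrite supported x e e∈ | supported y e e∈ = refl , eqₑ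
      ... | true  | eqₑ
        rewrite supported x′ e (trans (lookup-∁ A e) (cong not e∈)) | supported y′ e (trans (lookup-∁ A e) (cong not e∈))
              | xor-identityʳ (vector x e) | xor-identityʳ (vector y e) = eqₑ , refl

    join-injective : ∀ {g h} → join g ≗ join h → g ≗ h
    join-injective {g} {h} eq i with separate (kerA g) (kerA h) (ker∁A g) (ker∁A h) (λ e → eq (suc (suc e)))
    ... | eqA , eq∁A = subst (λ i → g i ≡ h i) (Fin.join-splitAt v w i) (on-part (splitAt v i))
      where
      on-left : left g ≗ left h
      on-left = Setoid.trans (Cube v) (Setoid.sym (Cube v) (P.inverseˡ {left g} {P.from (left g)} (refl , λ _ → refl)))
        (P.inverseˡ {left h} {P.from (left g)} (eq zero , eqA))
      on-right : right g ≗ right h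
      on-right = Setoid.trans (Cube w) (Setoid.sym (Cube w) (Q.inverseˡ {right g} {Q.from (right g)} (refl , λ _ → refl)))
        (Q.inverseˡ {right h} {Q.from (right g)} (eq (suc zero) , eq∁A))
      on-part : ∀ s → g (Fin.join v w s) ≡ h (Fin.join v w s)
      on-part (inj₁ i) = on-left i
      on-part (inj₂ i) = on-right i

  -- Vectors supported on A and on ∁ A can be recovered from their sum, so the two kernels embed
  -- jointly into GF(2)^n; the two extra bits account for the 2. The bound keeps the subtraction in
  -- `Genus` from being truncated.
  Corank-complementary : v + w ≤ 2 + n
  Corank-complementary = cube-injection⇒≤ join join-injective

degree-1⇒leaf : ∀ (SG : SignedGraph n) {v w u} → degree SG v ≡ 1 → Adjacent SG v w → w ≢ u → adj SG v u ≡ false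
degree-1⇒leaf SG {v} {w} {u} deg vw w≢u with adj SG v u in vu
... | false = refl
... | true  = contradiction (subst (∣ N ∣ ≤_) deg ℕ.≤-refl) (ℕ.<⇒≱ (begin-strict
    1                          ≤⟨ s≤s z≤n ⟩
    suc ∣ N Subset.- w Subset.- u ∣         ≤⟨ Subset.x∈p⇒∣p-x∣<∣p∣ (Subset.x∈p∧x≢y⇒x∈p-y (∈N vu) (w≢u ∘ sym)) ⟩
    ∣ N Subset.- w ∣                 <⟨ Subset.x∈p⇒∣p-x∣<∣p∣ (∈N vw) ⟩
    ∣ N ∣                      ∎))
  where
  open ℕ.≤-Reasoning
  N = tabulate (adj SG v)
  ∈N : ∀ {x} → adj SG v x ≡ true → x Subset.∈ N
  ∈N {x} vx = Vec.lookup⇒[]= x N (trans (Vec.lookup∘tabulate (adj SG v) x) vx)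

-- The tour of a bouquet

all?ᵇ : {P : Bool → Set} → (∀ b → Dec (P b)) → Dec (∀ b → P b)
all?ᵇ P? = map′ (λ { (p , q) false → p ; (p , q) true → q }) (λ p → p false , p true) (P? false ×-dec P? true)

odd : ℕ → Bool
odd zero    = false
odd (suc k) = not (odd k)

mult : Fin n → List (Fin n) → ℕ
mult f []      = 0
mult f (g ∷ l) = if does (f Fin.≟ g) then suc (mult f l) else mult f l

mult-++ : ∀ (f : Fin n) k l → mult f (k ++ l) ≡ mult f k + mult f l
mult-++ f []      l = refl
mult-++ f (g ∷ k) l with f Fin.≟ g
... | yes _ = cong suc (mult-++ f k l)
... | no  _ = mult-++ f k l

∉⇒mult≡0 : ∀ {f : Fin n} l → ¬ f ∈ˡ l → mult f l ≡ 0
∉⇒mult≡0 []      f∉ = refl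
∉⇒mult≡0 {f = f} (g ∷ l) f∉ with f Fin.≟ g
... | yes f≡g = contradiction (here f≡g) f∉
... | no  _   = ∉⇒mult≡0 l (f∉ ∘ there)

∈⇒mult>0 : ∀ {f : Fin n} {l} → f ∈ˡ l → 0 < mult f l
∈⇒mult>0 {f = f} (here refl) rewrite dec-true (f Fin.≟ f) refl = z<s
∈⇒mult>0 {f = f} {g ∷ l} (there f∈) with f Fin.≟ g
... | yes _ = z<s
... | no  _ = ∈⇒mult>0 f∈

mult>0⇒∈ : ∀ {f : Fin n} l → 0 < mult f l → f ∈ˡ l
mult>0⇒∈ {f = f} (g ∷ l) p with f Fin.≟ g
... | yes f≡g = here f≡g
... | no  _   = there (mult>0⇒∈ l p)

mult-self : ∀ (f : Fin n) l → mult f (f ∷ l) ≡ suc (mult f l)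
mult-self f l rewrite dec-true (f Fin.≟ f) refl = refl

mult-other : ∀ {f g : Fin n} l → f ≢ g → mult f (g ∷ l) ≡ mult f l
mult-other {f = f} {g} l f≢g rewrite dec-false (f Fin.≟ g) f≢g = refl

-- The net colour change along a stretch of the tour whose ends belong to the listed edges.
total : (Fin n → Bool) → List (Fin n) → Bool
total x []      = false
total x (e ∷ l) = x e xor total x l

total-++ : ∀ (x : Fin n → Bool) k l → total x (k ++ l) ≡ total x k xor total x l
total-++ x []      l = refl
total-++ x (e ∷ k) l = trans (cong (x e xor_) (total-++ x k l)) (sym (xor-assoc (x e) _ _))

total-cong : ∀ {x y : Fin n → Bool} → x ≗ y → ∀ l → total x l ≡ total y l
total-cong eq []      = refl
total-cong eq (e ∷ l) = cong₂ _xor_ (eq e) (total-cong eq l)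

sum-single : ∀ {n} (x : Fin n → Bool) g → sum (λ f → does (f Fin.≟ g) ∧ x f) ≡ x g
sum-single {suc n} x g = begin
  sum (λ f → does (f Fin.≟ g) ∧ x f)
    ≡⟨ sum-remove {i = g} (λ f → does (f Fin.≟ g) ∧ x f) ⟩
  (does (g Fin.≟ g) ∧ x g) xor sum (λ f → does (Fin.punchIn g f Fin.≟ g) ∧ x (Fin.punchIn g f))
    ≡⟨ cong₂ (λ a b → (a ∧ x g) xor b) (dec-true (g Fin.≟ g) refl)
        (sum-zero (λ f → cong (_∧ x (Fin.punchIn g f)) (dec-false (Fin.punchIn g f Fin.≟ g) (Fin.punchInᵢ≢i g f)))) ⟩
  x g xor false ≡⟨ xor-identityʳ (x g) ⟩
  x g ∎
  where open ≡-Reasoning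

-- Over GF(2) only the parity of each multiplicity survives. Once odd multiplicity between the two
-- ends of e is identified with interlacement, this sum becomes the off-diagonal part of a row of M.
total-sum : ∀ (x : Fin n → Bool) l → total x l ≡ sum (λ f → odd (mult f l) ∧ x f)
total-sum {n} x []  = sym (sum-replicate-zero n)
total-sum x (g ∷ l) = begin
  x g xor total x l
    ≡⟨ cong₂ _xor_ (sym (sum-single x g)) (total-sum x l) ⟩
  sum (λ f → does (f Fin.≟ g) ∧ x f) xor sum (λ f → odd (mult f l) ∧ x f)
    ≡⟨ ∑-distrib-+ (λ f → does (f Fin.≟ g) ∧ x f) (λ f → odd (mult f l) ∧ x f) ⟨
  sum (λ f → (does (f Fin.≟ g) ∧ x f) xor (odd (mult f l) ∧ x f))
    ≡⟨ sum-cong-≗ (λ f → collect (does (f Fin.≟ g)) (mult f l) (x f)) ⟩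
  sum (λ f → odd (mult f (g ∷ l)) ∧ x f) ∎
  where
  open ≡-Reasoning
  collect : ∀ b m c → (b ∧ c) xor (odd m ∧ c) ≡ odd (if b then suc m else m) ∧ c
  collect false m c     = refl
  collect true  m false rewrite ∧-zeroʳ (odd m) | ∧-zeroʳ (not (odd m)) = refl
  collect true  m true  rewrite ∧-identityʳ (odd m) | ∧-identityʳ (not (odd m)) = refl

module Alternation {e f : Fin n} (f≢e : f ≢ e) where

  -- The displayed e is the earliest place to which the leading e can be matched, so the rest of the
  -- pattern lies behind it.
  peel : ∀ β {l γ} → ¬ e ∈ˡ β → e ∷ l ⊆ β ++ e ∷ γ → l ⊆ γ
  peel []      e∉ (.e ∷ʳ p) = drop p
    where
    drop : ∀ {l γ} → e ∷ l ⊆ γ → l ⊆ γ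
    drop (y ∷ʳ p) = y ∷ʳ drop p
    drop (_ ∷ p)  = _ ∷ʳ p
  peel []      e∉ (_ ∷ p)  = p
  peel (b ∷ β) e∉ (_ ∷ʳ p) = peel β (e∉ ∘ there) p
  peel (b ∷ β) e∉ (e≡b ∷ p) = contradiction (here e≡b) e∉

  -- As the pattern does not fit into γ and f differs from e, the leading f has to be matched before
  -- the displayed e, that is, in β.
  alternate : ∀ β {l γ} → ¬ e ∈ˡ β → ¬ (f ∷ e ∷ l ⊆ γ) → f ∷ e ∷ l ⊆ β ++ e ∷ γ → f ∈ˡ β × l ⊆ γ
  alternate []      e∉ ¬γ (_ ∷ʳ p) = contradiction p ¬γ
  alternate []      e∉ ¬γ (f≡e ∷ p) = contradiction f≡e f≢e
  alternate (b ∷ β) e∉ ¬γ (_ ∷ʳ p) with alternate β (e∉ ∘ there) ¬γ p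
  ... | f∈ , q = there f∈ , q
  alternate (b ∷ β) e∉ ¬γ (f≡b ∷ p) = here f≡b , peel β (e∉ ∘ there) p

  module _ {α β γ} (e∉α : ¬ e ∈ˡ α) (e∉β : ¬ e ∈ˡ β) (e∉γ : ¬ e ∈ˡ γ)
    (twice : mult f (α ++ e ∷ β ++ e ∷ γ) ≡ 2) where

    private
      T = α ++ e ∷ β ++ e ∷ γ

      mults : mult f α + (mult f β + mult f γ) ≡ 2
      mults = trans (sym (trans (mult-++ f α _) (cong (mult f α +_)
        (trans (mult-other (β ++ e ∷ γ) f≢e) (trans (mult-++ f β _) (cong (mult f β +_) (mult-other γ f≢e))))))) twice

      e∉ : ∀ {l} → ¬ (f ∷ e ∷ l ⊆ γ)
      e∉ p = e∉γ (second p)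
        where
        first : ∀ {g l γ} → g ∷ l ⊆ γ → g ∈ˡ γ
        first (_ ∷ʳ p) = there (first p)
        first (eq ∷ p) = here eq
        second : ∀ {g h l γ} → g ∷ h ∷ l ⊆ γ → h ∈ˡ γ
        second (_ ∷ʳ p) = there (second p)
        second (_ ∷ p)  = there (first p)

      one : ∀ a b c → a + (b + c) ≡ 2 → 0 < b → 0 < a ⊎ 0 < c → b ≡ 1
      one a             1             c eq _ _ = refl
      one (suc zero)    (suc (suc b)) c () _ _
      one (suc (suc a)) (suc (suc b)) c eq _ _ with a
      ... | zero  = contradiction eq λ ()
      ... | suc _ = contradiction (ℕ.suc-injective (ℕ.suc-injective eq)) λ ()
      one zero (suc (suc zero)) (suc c) () _ _
      one zero (suc (suc (suc b))) (suc c) () _ _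
      one zero (suc (suc b)) zero eq _ (inj₁ ())
      one zero (suc (suc b)) zero eq _ (inj₂ ())

      odd-β : f ∈ˡ β → f ∈ˡ α ⊎ f ∈ˡ γ → odd (mult f β) ≡ true
      odd-β f∈β (inj₁ f∈α) rewrite one (mult f α) (mult f β) (mult f γ) mults (∈⇒mult>0 f∈β) (inj₁ (∈⇒mult>0 f∈α)) = refl
      odd-β f∈β (inj₂ f∈γ) rewrite one (mult f α) (mult f β) (mult f γ) mults (∈⇒mult>0 f∈β) (inj₂ (∈⇒mult>0 f∈γ)) = refl

      odd-split : ∀ a b c → a + (b + c) ≡ 2 → odd b ≡ true → 0 < b × (0 < a ⊎ 0 < c)
      odd-split (suc a) (suc b) c eq o = z<s , inj₁ z<s
      odd-split zero (suc zero) (suc c) eq o = z<s , inj₂ z<s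
      odd-split zero (suc (suc zero)) (suc c) () o
      odd-split zero (suc (suc (suc b))) c () o

    -- Both patterns put one f between the two occurrences of e and another one outside: in γ for
    -- the first pattern, in α for the second. As f occurs twice in all, its multiplicity in β is
    -- exactly 1.
    alternating⇒odd : (e ∷ f ∷ e ∷ f ∷ [] ⊆ T) ⊎ (f ∷ e ∷ f ∷ e ∷ [] ⊆ T) → odd (mult f β) ≡ true
    alternating⇒odd (inj₁ p) with alternate β e∉β e∉ (peel α e∉α p)
    ... | f∈β , q = odd-β f∈β (inj₂ (to∈ q))
    alternating⇒odd (inj₂ p) with alternate α e∉α ¬R p
      where
      ¬R : ¬ (f ∷ e ∷ f ∷ e ∷ [] ⊆ β ++ e ∷ γ)
      ¬R q = e∉ (proj₂ (alternate β e∉β e∉ q))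
    ... | f∈α , q with alternate β e∉β e∉ q
    ...   | f∈β , _ = odd-β f∈β (inj₁ f∈α)

    odd⇒alternating : odd (mult f β) ≡ true → (e ∷ f ∷ e ∷ f ∷ [] ⊆ T) ⊎ (f ∷ e ∷ f ∷ e ∷ [] ⊆ T)
    odd⇒alternating o with odd-split (mult f α) (mult f β) (mult f γ) mults o
    ... | 0<β , inj₁ 0<α = inj₂ (++⁺ (from∈ (mult>0⇒∈ α 0<α)) (refl ∷ ++⁺ (from∈ (mult>0⇒∈ β 0<β)) (refl ∷ minimum γ)))
    ... | 0<β , inj₂ 0<γ = inj₁ (++⁺ (minimum α) (refl ∷ ++⁺ (from∈ (mult>0⇒∈ β 0<β)) (refl ∷ from∈ (mult>0⇒∈ γ 0<γ))))

does-≡ : ∀ {P : Set} {b} (P? : Dec P) → (P → b ≡ true) → (b ≡ true → P) → does P? ≡ b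
does-≡ (yes p) to from = sym (to p)
does-≡ {b = false} (no ¬p) to from = refl
does-≡ {b = true}  (no ¬p) to from = contradiction (from refl) ¬p

acrossEnd-involutive : ∀ (y : Flag n) → acrossEnd (acrossEnd y) ≡ y
acrossEnd-involutive (e , i , s) = cong (λ s → e , i , s) (not-involutive s)

acrossEnd-fixfree : ∀ (y : Flag n) → acrossEnd y ≢ y
acrossEnd-fixfree (e , i , s) eq = not-¬ refl (sym (cong (proj₂ ∘ proj₂) eq))

alongSide-involutive : ∀ (y : Flag n) → alongSide (alongSide y) ≡ y
alongSide-involutive (e , i , s) = cong (λ i → e , i , s) (not-involutive i)

alongSide-fixfree : ∀ (y : Flag n) → alongSide y ≢ y
alongSide-fixfree (e , i , s) eq = not-¬ refl (sym (cong (proj₁ ∘ proj₂) eq))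

-- The arcs on the boundary of the spanning ribbon subgraph with edge set A
-- that do not lie on the boundary of the vertex-discs.
free : Subset n → Flag n → Flag n
free A y = if lookup A (edgeOf y) then alongSide y else acrossEnd y

-- Positions of the edge-ends on the boundary of the vertex

module Tour {m} (B : Bouquet (suc m)) where

  G = graph B

  open Involutions acrossEnd (arc G) acrossEnd-involutive (arc-involutive G)
    using (rotate; onCycle; iter-∸; no-crossing; ∃-period; transitive⇒≤period)

  open ≡-Reasoning

  2n = 2 * suc m

  base : Flag (suc m)
  base = zero , false , false

  entry : ℕ → Flag (suc m)
  entry = iter rotate base

  -- With an edge present the list of flags is nonempty, so the number of curves evaluates to a
  -- successor, which already accounts for the one vertex.
  isolated≡0 : isolated G ≡ 0
  isolated≡0 = ℕ.m+n≡0⇒n≡0 _ (ℕ.suc-injective (one-vertex B))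

  reachable : ∀ y → Orbit acrossEnd (arc G) base y
  reachable y = Orbit-swap (Curves.single-curve⇒transitive (arc G) acrossEnd
    (arc-involutive G) acrossEnd-involutive (arc-fixfree G) acrossEnd-fixfree
    (trans (sym (ℕ.+-identityʳ _)) (trans (cong (#curves (arc G) acrossEnd +_) (sym isolated≡0)) (one-vertex B)))
    base y)

  4n≡ : suc m * 4 ≡ 2n * 2
  4n≡ = trans (sym (ℕ.*-assoc (suc m) 2 2)) (cong (λ k → k * 2) (ℕ.*-comm (suc m) 2))

  period≥2n : ∀ {q} → entry (suc q) ≡ base → 2n ≤ suc q
  period≥2n {q} period = ℕ.*-cancelʳ-≤ 2n (suc q) 2 (subst (_≤ suc q * 2) 4n≡
    (transitive⇒≤period acrossEnd-fixfree (arc-fixfree G) flag↔Fin {q} reachable period))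

  -- Pigeonhole gives a period of at most 2n, and transitivity forces at least 2n. Hence the tour
  -- closes up exactly after all 2n edge-ends.
  entry-2n : entry 2n ≡ base
  entry-2n with ∃-period acrossEnd-fixfree (arc-fixfree G) flag↔Fin base (suc 2n)
      (subst (_< suc 2n * 2) (sym 4n≡) (ℕ.m<n⇒m<1+n (ℕ.n<1+n (2n * 2))))
  ... | q , s≤s q<2n , period = subst (λ k → entry k ≡ base) (ℕ.≤-antisym q<2n (period≥2n period)) period

  entry-injective-< : ∀ {i j} → i < j → j < 2n → entry i ≢ entry j
  entry-injective-< {i} {j} i<j j<2n eq with j ∸ i | ℕ.m∸n≤m j i | iter-∸ base (ℕ.<⇒≤ i<j) eq | ℕ.m<n⇒0<n∸m i<j
  ... | suc q | q<j | p | _ = contradiction j<2n (ℕ.≤⇒≯ (ℕ.≤-trans (period≥2n p) q<j))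

  entry-injective : ∀ {i j} → i < 2n → j < 2n → entry i ≡ entry j → i ≡ j
  entry-injective {i} {j} i<2n j<2n eq with ℕ.<-cmp i j
  ... | tri< i<j _ _ = contradiction eq (entry-injective-< i<j j<2n)
  ... | tri≈ _ i≡j _ = i≡j
  ... | tri> _ _ j<i = contradiction (sym eq) (entry-injective-< j<i i<2n)

  entry≢exit : ∀ i j → entry i ≢ acrossEnd (entry j)
  entry≢exit = no-crossing acrossEnd-fixfree (arc-fixfree G) base

  Position : Flag (suc m) → Set
  Position y = ∃ λ j → j < 2n × (y ≡ entry j ⊎ y ≡ acrossEnd (entry j))

  opaque
    position : ∀ y → Position y
    position y = onCycle entry-2n (reachable y)

  opaque
    -- Of the two corners of an end, one is an entry; if the corner on side `false` is an exit, the
    -- entry is the corner opposite.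
    entry-of : ∀ e i → ∃₂ λ j s → j < 2n × entry j ≡ (e , i , s)
    entry-of e i with position (e , i , false)
    ... | j , j<2n , inj₁ eq = j , false , j<2n , sym eq
    ... | j , j<2n , inj₂ eq = j , true , j<2n , trans (sym (acrossEnd-involutive (entry j))) (cong acrossEnd (sym eq))

  entry-unique : ∀ {e i j k s t} → j < 2n → k < 2n → entry j ≡ (e , i , s) → entry k ≡ (e , i , t) → j ≡ k × s ≡ t
  entry-unique {e} {i} {j} {k} {s} {t} j<2n k<2n eq eq′ with s Bool.≟ t
  ... | yes refl = entry-injective j<2n k<2n (trans eq (sym eq′)) , refl
  ... | no s≢t   = contradiction (trans eq (trans (cong (λ s → e , i , s) (¬-not s≢t)) (cong acrossEnd (sym eq′))))
                     (entry≢exit j k)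

  edges : Flag (suc m) → ℕ → List (Fin (suc m))
  edges y k = map edgeOf (iterate rotate y k)

  edges-+ : ∀ y j k → edges y (j + k) ≡ edges y j ++ edges (iter rotate y j) k
  edges-+ y zero    k = refl
  edges-+ y (suc j) k = cong (edgeOf y ∷_) (edges-+ (rotate y) j k)

  ∈-edges : ∀ {e} y k → e ∈ˡ edges y k → ∃ λ j → j < k × edgeOf (iter rotate y j) ≡ e
  ∈-edges y (suc k) (here eq) = 0 , z<s , sym eq
  ∈-edges y (suc k) (there e∈) with ∈-edges (rotate y) k e∈
  ... | j , j<k , eq = suc j , s≤s j<k , eq

  ∈-iterate⁺ : ∀ y {j k} → j < k → iter rotate y j ∈ iterate rotate y k
  ∈-iterate⁺ y {zero}  {suc k} _         = here refl
  ∈-iterate⁺ y {suc j} {suc k} (s≤s j<k) = there (∈-iterate⁺ (rotate y) j<k)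

  ∈-iterate⁻ : ∀ y k {z} → z ∈ iterate rotate y k → ∃ λ j → j < k × iter rotate y j ≡ z
  ∈-iterate⁻ y (suc k) (here eq) = 0 , z<s , sym eq
  ∈-iterate⁻ y (suc k) (there z∈) with ∈-iterate⁻ (rotate y) k z∈
  ... | j , j<k , eq = suc j , s≤s j<k , eq

  -- The tour reads α ++ e ∷ β ++ e ∷ γ, entering e first at its end i.
  record Ends (e : Fin (suc m)) : Set where
    field
      i s t   : Bool
      k d r   : ℕ
      length≡ : 2n ≡ k + suc (d + suc r)
      first   : entry k ≡ (e , i , s)
      second  : entry (k + suc d) ≡ (e , not i , t)

    k<2n : k < 2n
    k<2n = subst (k <_) (sym length≡) (ℕ.m<m+n k z<s)

    k+d<2n : k + suc d < 2n
    k+d<2n = subst (k + suc d <_) (sym (trans length≡ (sym (ℕ.+-assoc k (suc d) (suc r))))) (ℕ.m<m+n (k + suc d) z<s)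

    y₁ y₂ : Flag (suc m)
    y₁ = rotate (entry k)
    y₂ = rotate (entry (k + suc d))

    α β γ : List (Fin (suc m))
    α = edges base k
    β = edges y₁ d
    γ = edges y₂ r

    y₁-d : iter rotate y₁ d ≡ entry (k + suc d)
    y₁-d = sym (iter-+ rotate base k (suc d))

    tour-split : edges base 2n ≡ α ++ e ∷ β ++ e ∷ γ
    tour-split = begin
      edges base 2n                                        ≡⟨ cong (edges base) length≡ ⟩
      edges base (k + suc (d + suc r))                     ≡⟨ edges-+ base k _ ⟩
      α ++ edgeOf (entry k) ∷ edges y₁ (d + suc r)         ≡⟨ cong₂ (λ e l → α ++ e ∷ l) (cong edgeOf first) (edges-+ y₁ d (suc r)) ⟩
      α ++ e ∷ β ++ edges (iter rotate y₁ d) (suc r)       ≡⟨ cong (λ y → α ++ e ∷ β ++ edges y (suc r)) y₁-d ⟩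
      α ++ e ∷ β ++ edgeOf (entry (k + suc d)) ∷ γ         ≡⟨ cong (λ e′ → α ++ e ∷ β ++ e′ ∷ γ) (cong edgeOf second) ⟩
      α ++ e ∷ β ++ e ∷ γ                                  ∎

    only : ∀ {j} → j < 2n → edgeOf (entry j) ≡ e → j ≡ k ⊎ j ≡ k + suc d
    only {j} j<2n eq with entry j in eqⱼ
    only {j} j<2n refl | _ , i′ , s′ with i′ Bool.≟ i
    ... | yes refl = inj₁ (proj₁ (entry-unique j<2n k<2n eqⱼ first))
    ... | no i′≢i  = inj₂ (proj₁ (entry-unique j<2n k+d<2n (trans eqⱼ (cong (λ i → _ , i , s′) (¬-not i′≢i))) second))

    e∉α : ¬ e ∈ˡ α
    e∉α e∈ with ∈-edges base k e∈
    ... | j , j<k , eq with only (ℕ.<-trans j<k k<2n) eq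
    ...   | inj₁ refl = ℕ.<-irrefl refl j<k
    ...   | inj₂ refl = ℕ.m+n≮m k (suc d) j<k

    e∉β : ¬ e ∈ˡ β
    e∉β e∈ with ∈-edges y₁ d e∈
    ... | j , j<d , eq with only (ℕ.<-trans (ℕ.+-monoʳ-< k (s≤s j<d)) k+d<2n) (trans (cong edgeOf (iter-+ rotate base k (suc j))) eq)
    ...   | inj₁ eq′ = ℕ.<-irrefl (sym eq′) (ℕ.m<m+n k z<s)
    ...   | inj₂ eq′ = ℕ.<-irrefl (ℕ.suc-injective (ℕ.+-cancelˡ-≡ k _ _ eq′)) j<d

    e∉γ : ¬ e ∈ˡ γ
    e∉γ e∈ with ∈-edges y₂ r e∈
    ... | j , j<r , eq with only
          (subst (k + suc d + suc j <_) (sym (trans length≡ (sym (ℕ.+-assoc k (suc d) (suc r))))) (ℕ.+-monoʳ-< (k + suc d) (s≤s j<r)))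
          (trans (cong edgeOf (iter-+ rotate base (k + suc d) (suc j))) eq)
    ...   | inj₁ eq′ = ℕ.<-irrefl (sym (trans (sym (ℕ.+-assoc k (suc d) (suc j))) eq′)) (ℕ.m<m+n k z<s)
    ...   | inj₂ eq′ = ℕ.<-irrefl (sym eq′) (ℕ.m<m+n (k + suc d) z<s)

  opaque
    ends : ∀ e → Ends e
    ends e with entry-of e false | entry-of e true
    ... | j , s , j<2n , eq | j′ , s′ , j′<2n , eq′ with ℕ.<-cmp j j′
    ...   | tri≈ _ refl _ = contradiction (trans (sym eq) eq′) λ ()
    ...   | tri< j<j′ _ _ = record
      { i = false ; s = s ; t = s′ ; k = j ; d = j′ ∸ suc j ; r = 2n ∸ suc j′
      ; length≡ = trans (sym (ℕ.m+[n∸m]≡n j′<2n)) (trans (sym (ℕ.+-suc j′ _)) (trans (cong (_+ suc (2n ∸ suc j′)) j′≡) (ℕ.+-assoc j _ _)))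
      ; first = eq ; second = subst (λ j → entry j ≡ _) j′≡ eq′ }
      where
      j′≡ : j′ ≡ j + suc (j′ ∸ suc j)
      j′≡ = trans (sym (ℕ.m+[n∸m]≡n j<j′)) (sym (ℕ.+-suc j _))
    ...   | tri> _ _ j′<j = record
      { i = true ; s = s′ ; t = s ; k = j′ ; d = j ∸ suc j′ ; r = 2n ∸ suc j
      ; length≡ = trans (sym (ℕ.m+[n∸m]≡n j<2n)) (trans (sym (ℕ.+-suc j _)) (trans (cong (_+ suc (2n ∸ suc j)) j≡) (ℕ.+-assoc j′ _ _)))
      ; first = eq′ ; second = subst (λ j → entry j ≡ _) j≡ eq }
      where
      j≡ : j ≡ j′ + suc (j ∸ suc j′)
      j≡ = trans (sym (ℕ.m+[n∸m]≡n j′<j)) (sym (ℕ.+-suc j′ _))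

  mult-tour : ∀ e → mult e (edges base 2n) ≡ 2
  mult-tour e = begin
    mult e (edges base 2n)                           ≡⟨ cong (mult e) tour-split ⟩
    mult e (α ++ e ∷ β ++ e ∷ γ)                     ≡⟨ mult-++ e α _ ⟩
    mult e α + mult e (e ∷ β ++ e ∷ γ)               ≡⟨ cong₂ _+_ (∉⇒mult≡0 α e∉α) (mult-self e (β ++ e ∷ γ)) ⟩
    suc (mult e (β ++ e ∷ γ))                        ≡⟨ cong suc (mult-++ e β (e ∷ γ)) ⟩
    suc (mult e β + mult e (e ∷ γ))                  ≡⟨ cong suc (cong₂ _+_ (∉⇒mult≡0 β e∉β) (mult-self e γ)) ⟩
    suc (suc (mult e γ))                             ≡⟨ cong (2 +_) (∉⇒mult≡0 γ e∉γ) ⟩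
    2                                                ∎
    where open Ends (ends e)

  total-tour : ∀ x → total x (edges base 2n) ≡ false
  total-tour x = trans (total-sum x (edges base 2n)) (sum-zero (λ f → cong (λ k → odd k ∧ x f) (mult-tour f)))

  -- The case e = f is consistent as well: e does not occur in β, so its multiplicity there is even.
  does-interlaced : ∀ e f → does (interlaced? B e f) ≡ odd (mult f (Ends.β (ends e)))
  does-interlaced e f = does-≡ (interlaced? B e f)
    (λ (e≢f , alt) → Alternation.alternating⇒odd (e≢f ∘ sym) e∉α e∉β e∉γ twice (subst Alternating tour-split alt))
    (λ o → e≢f o , subst Alternating (sym tour-split) (Alternation.odd⇒alternating (e≢f o ∘ sym) e∉α e∉β e∉γ twice o))
    where
    open Ends (ends e)
    Alternating : List (Fin (suc m)) → Set
    Alternating T = (e ∷ f ∷ e ∷ f ∷ [] ⊆ T) ⊎ (f ∷ e ∷ f ∷ e ∷ [] ⊆ T)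
    twice : mult f (α ++ e ∷ β ++ e ∷ γ) ≡ 2
    twice = trans (cong (mult f) (sym tour-split)) (mult-tour f)
    e≢f : odd (mult f β) ≡ true → e ≢ f
    e≢f o refl = contradiction (trans (sym o) (cong odd (∉⇒mult≡0 β e∉β))) λ ()

  does-twisted : ∀ e → does (twisted? B e) ≡ not (Ends.s (ends e) xor Ends.t (ends e))
  does-twisted e = does-≡ (twisted? B e)
    (λ { (inj₁ (p , q)) → xnor-same (sides p q) ; (inj₂ (p , q)) → xnor-same (sides p q) })
    (λ s=t → twisted i s first∈ (subst (λ t → (e , not i , t) ∈ tour B) (sym (xnor⇒≡ s=t)) second∈))
    where
    open Ends (ends e)
    xnor-same : ∀ {s t} → s ≡ t → not (s xor t) ≡ true
    xnor-same {s} refl = cong not (xor-same s)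
    xnor⇒≡ : ∀ {s t} → not (s xor t) ≡ true → s ≡ t
    xnor⇒≡ {false} {false} _ = refl
    xnor⇒≡ {true}  {true}  _ = refl
    first∈ : (e , i , s) ∈ tour B
    first∈ = subst (_∈ tour B) first (∈-iterate⁺ base k<2n)
    second∈ : (e , not i , t) ∈ tour B
    second∈ = subst (_∈ tour B) second (∈-iterate⁺ base k+d<2n)
    twisted : ∀ i s → (e , i , s) ∈ tour B → (e , not i , s) ∈ tour B → Twisted B e
    twisted false false p q = inj₁ (p , q)
    twisted true  false p q = inj₁ (q , p)
    twisted false true  p q = inj₂ (p , q)
    twisted true  true  p q = inj₂ (q , p)
    side : ∀ {i s j s′} → j < 2n → entry j ≡ (e , i , s) → (e , i , s′) ∈ tour B → s ≡ s′
    side j<2n eq p with ∈-iterate⁻ base 2n p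
    ... | j′ , j′<2n , eq′ = proj₂ (entry-unique j<2n j′<2n eq eq′)
    pick : ∀ i {s} → (e , false , s) ∈ tour B → (e , true , s) ∈ tour B → (e , i , s) ∈ tour B
    pick false p q = p
    pick true  p q = q
    sides : ∀ {s′} → (e , false , s′) ∈ tour B → (e , true , s′) ∈ tour B → s ≡ t
    sides p q = trans (side k<2n first (pick i p q)) (sym (side k+d<2n second (pick (not i) p q)))

  -- Colourings of the vertex boundary with prescribed jumps

  record Potential (x : Fin (suc m) → Bool) (c : Flag (suc m) → Bool) : Set where
    field
      jump  : ∀ y → c (acrossEnd y) ≡ c y xor x (edgeOf y)
      along : ∀ y → c (arc G y) ≡ c y

    along-iter : ∀ y k → c (iter rotate y k) ≡ c y xor total x (edges y k)
    along-iter y zero    = sym (xor-identityʳ (c y))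
    along-iter y (suc k) = begin
      c (iter rotate (rotate y) k)                            ≡⟨ along-iter (rotate y) k ⟩
      c (rotate y) xor total x (edges (rotate y) k)
        ≡⟨ cong (_xor total x (edges (rotate y) k)) (trans (along (acrossEnd y)) (jump y)) ⟩
      (c y xor x (edgeOf y)) xor total x (edges (rotate y) k) ≡⟨ xor-assoc (c y) _ _ ⟩
      c y xor total x (edges y (suc k))                       ∎
  open Potential

  -- The tour visits every flag as an entry or an exit, so the jumps carry the colour of `base` to
  -- all flags.
  potential-unique : ∀ {x x′ c c′} → Potential x c → Potential x′ c′ → x ≗ x′ → c base ≡ c′ base → c ≗ c′
  potential-unique {c = c} {c′} P P′ x≗x′ c≡c′ y = at y (position y)
    where
    at-entry : ∀ j → c (entry j) ≡ c′ (entry j)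
    at-entry j = trans (along-iter P base j) (trans (cong₂ _xor_ c≡c′ (total-cong x≗x′ (edges base j))) (sym (along-iter P′ base j)))
    at : ∀ y → Position y → c y ≡ c′ y
    at _ (j , _ , inj₁ refl) = at-entry j
    at _ (j , _ , inj₂ refl) = trans (jump P (entry j)) (trans (cong₂ _xor_ (at-entry j) (x≗x′ _)) (sym (jump P′ (entry j))))

  -- Row e of M can be read off the tour: equal sides of entry give the diagonal term, and the edges
  -- met between the two entries give the rest.
  row-SI : ∀ x e → row (SI B) x e ≡ (not (Ends.s (ends e) xor Ends.t (ends e)) ∧ x e) xor total x (Ends.β (ends e))
  row-SI x e = cong₂ _xor_
    (cong (_∧ x e) (trans (negative-if (does (twisted? B e))) (does-twisted e)))
    (trans (sum-cong-≗ (λ f → cong (_∧ x f) (does-interlaced e f))) (sym (total-sum x (Ends.β (ends e)))))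
    where
    negative-if : ∀ b → negative (if b then Sign.- else Sign.+) ≡ b
    negative-if false = refl
    negative-if true  = refl

  -- Between the two entries into e, the colour changes once for every end met.
  row-potential : ∀ {x c} → Potential x c → ∀ e s → c (e , true , s) ≡ c (e , false , s) xor row (SI B) x e
  row-potential {x} {c} P e u = flip i (begin
    c (e , not i , u)
      ≡⟨ side (not i) t u ⟩
    c (e , not i , t) xor ((u xor t) ∧ x e)
      ≡⟨ cong (λ y → c y xor ((u xor t) ∧ x e)) second ⟨
    c (entry (k + suc d)) xor ((u xor t) ∧ x e)
      ≡⟨ cong (λ y → c y xor ((u xor t) ∧ x e)) (iter-+ rotate base k (suc d)) ⟩
    c (iter rotate (entry k) (suc d)) xor ((u xor t) ∧ x e)
      ≡⟨ cong (_xor ((u xor t) ∧ x e)) (along-iter P (entry k) (suc d)) ⟩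
    (c (entry k) xor (x (edgeOf (entry k)) xor total x β)) xor ((u xor t) ∧ x e)
      ≡⟨ cong (λ y → (c y xor (x (edgeOf y) xor total x β)) xor ((u xor t) ∧ x e)) first ⟩
    (c (e , i , s) xor (x e xor total x β)) xor ((u xor t) ∧ x e)
      ≡⟨ rearrange-bits (c (e , i , s)) (x e) (total x β) s t u ⟩
    (c (e , i , s) xor ((u xor s) ∧ x e)) xor ((not (s xor t) ∧ x e) xor total x β)
      ≡⟨ cong₂ _xor_ (sym (side i s u)) (sym (row-SI x e)) ⟩
    c (e , i , u) xor row (SI B) x e ∎)
    where
    open Ends (ends e)
    flip : ∀ i → c (e , not i , u) ≡ c (e , i , u) xor row (SI B) x e → c (e , true , u) ≡ c (e , false , u) xor row (SI B) x e
    flip false eq = eq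
    flip true  eq = begin
      c (e , true , u)                                                ≡⟨ xor-identityʳ _ ⟨
      c (e , true , u) xor false                                      ≡⟨ cong (c (e , true , u) xor_) (xor-same (row (SI B) x e)) ⟨
      c (e , true , u) xor (row (SI B) x e xor row (SI B) x e)        ≡⟨ xor-assoc (c (e , true , u)) _ _ ⟨
      (c (e , true , u) xor row (SI B) x e) xor row (SI B) x e        ≡⟨ cong (_xor row (SI B) x e) eq ⟨
      c (e , false , u) xor row (SI B) x e                            ∎
    side : ∀ i s u → c (e , i , u) ≡ c (e , i , s) xor ((u xor s) ∧ x e)
    side i false false = sym (xor-identityʳ _)
    side i true  true  = sym (xor-identityʳ _)
    side i false true  = jump P (e , i , false)
    side i true  false = jump P (e , i , true)
    -- Checked on all 64 assignments. The coefficient of x e is 1 + u + t on both sides, since s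
    -- cancels on the right.
    rearrange-bits = from-yes (all?ᵇ λ a → all?ᵇ λ b → all?ᵇ λ c → all?ᵇ λ s → all?ᵇ λ t → all?ᵇ λ u →
      ((a xor (b xor c)) xor ((u xor t) ∧ b)) Bool.≟ ((a xor ((u xor s) ∧ b)) xor ((not (s xor t) ∧ b) xor c)))

  module FromVector (b : Bool) (x : Fin (suc m) → Bool) where

    -- An exit comes after the jump at its own end, hence the prefix of length `suc j`.
    at : ∀ {y} → Position y → Bool
    at (j , _ , inj₁ _) = b xor total x (edges base j)
    at (j , _ , inj₂ _) = b xor total x (edges base (suc j))

    at-unique : ∀ {y} (p q : Position y) → at p ≡ at q
    at-unique (i , i< , inj₁ p) (j , j< , inj₁ q) = cong (λ j → b xor total x (edges base j)) (entry-injective i< j< (trans (sym p) q))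
    at-unique (i , _ , inj₁ p) (j , _ , inj₂ q) = contradiction (trans (sym p) q) (entry≢exit i j)
    at-unique (i , _ , inj₂ p) (j , _ , inj₁ q) = contradiction (trans (sym q) p) (entry≢exit j i)
    at-unique (i , i< , inj₂ p) (j , j< , inj₂ q) = cong (λ j → b xor total x (edges base (suc j)))
      (entry-injective i< j< (involutive⇒injective acrossEnd acrossEnd-involutive (trans (sym p) q)))

    value : Flag (suc m) → Bool
    value y = at (position y)

    value-entry : ∀ {j} → j < 2n → value (entry j) ≡ b xor total x (edges base j)
    value-entry {j} j<2n = at-unique (position (entry j)) (j , j<2n , inj₁ refl)

    value-exit : ∀ {j} → j < 2n → value (acrossEnd (entry j)) ≡ b xor total x (edges base (suc j))
    value-exit {j} j<2n = at-unique (position (acrossEnd (entry j))) (j , j<2n , inj₂ refl)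

    total-suc : ∀ j → total x (edges base (suc j)) ≡ total x (edges base j) xor x (edgeOf (entry j))
    total-suc j = begin
      total x (edges base (suc j))                                ≡⟨ cong (total x ∘ edges base) (ℕ.+-comm 1 j) ⟩
      total x (edges base (j + 1))                                ≡⟨ cong (total x) (edges-+ base j 1) ⟩
      total x (edges base j ++ edgeOf (entry j) ∷ [])             ≡⟨ total-++ x (edges base j) _ ⟩
      total x (edges base j) xor (x (edgeOf (entry j)) xor false) ≡⟨ cong (total x (edges base j) xor_) (xor-identityʳ _) ⟩
      total x (edges base j) xor x (edgeOf (entry j))             ∎

    jump-entry : ∀ {j} → j < 2n → value (acrossEnd (entry j)) ≡ value (entry j) xor x (edgeOf (entry j))
    jump-entry {j} j<2n = begin
      value (acrossEnd (entry j))                             ≡⟨ value-exit j<2n ⟩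
      b xor total x (edges base (suc j))                      ≡⟨ cong (b xor_) (total-suc j) ⟩
      b xor (total x (edges base j) xor x (edgeOf (entry j))) ≡⟨ xor-assoc b _ _ ⟨
      (b xor total x (edges base j)) xor x (edgeOf (entry j)) ≡⟨ cong (_xor x (edgeOf (entry j))) (value-entry j<2n) ⟨
      value (entry j) xor x (edgeOf (entry j))                ∎

    xor-cancel : ∀ {a b c} → a ≡ b xor c → b ≡ a xor c
    xor-cancel {b = b} {c} refl = sym (trans (xor-assoc b c c) (trans (cong (b xor_) (xor-same c)) (xor-identityʳ b)))

    value-jump : ∀ y → value (acrossEnd y) ≡ value y xor x (edgeOf y)
    value-jump y with position y in eq
    ... | j , j<2n , inj₁ refl = trans (jump-entry j<2n) (cong (_xor x (edgeOf (entry j))) (value-entry j<2n))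
    ... | j , j<2n , inj₂ refl = begin
      value (acrossEnd (acrossEnd (entry j)))                     ≡⟨ cong value (acrossEnd-involutive (entry j)) ⟩
      value (entry j)                                             ≡⟨ xor-cancel (jump-entry j<2n) ⟩
      value (acrossEnd (entry j)) xor x (edgeOf (entry j))        ≡⟨ cong (_xor x (edgeOf (entry j))) (value-exit j<2n) ⟩
      (b xor total x (edges base (suc j))) xor x (edgeOf (entry j)) ∎

    value-rotate : ∀ {j} → j < 2n → value (rotate (entry j)) ≡ value (acrossEnd (entry j))
    value-rotate {j} j<2n = trans (cong value (sym (iter-suc rotate base j))) (helper (ℕ.m≤n⇒m<n∨m≡n j<2n))
      where
      helper : suc j < 2n ⊎ suc j ≡ 2n → value (entry (suc j)) ≡ value (acrossEnd (entry j))
      helper (inj₁ j+1<2n) = trans (value-entry j+1<2n) (sym (value-exit j<2n))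
      -- Closing the tour is the only obstruction to the existence of a potential. It vanishes for
      -- every x because each edge is met twice.
      helper (inj₂ j+1≡2n) = begin
        value (entry (suc j))                ≡⟨ cong value (trans (cong entry j+1≡2n) entry-2n) ⟩
        value (entry 0)                      ≡⟨ value-entry z<s ⟩
        b xor false                          ≡⟨ cong (b xor_) (total-tour x) ⟨
        b xor total x (edges base 2n)        ≡⟨ cong (λ k → b xor total x (edges base k)) j+1≡2n ⟨
        b xor total x (edges base (suc j))   ≡⟨ value-exit j<2n ⟨
        value (acrossEnd (entry j))          ∎

    -- The arc at an entry leads back to the exit of the preceding end, so `value-arc` at an entry
    -- reduces to `value-rotate` one place earlier; at position 0 this wraps around to the last end.
    predecessor : ∀ j → j < 2n → ∃ λ k → k < 2n × entry j ≡ rotate (entry k)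
    predecessor zero    _    = pred 2n , ℕ.n<1+n _ , trans (sym entry-2n) (iter-suc rotate base (pred 2n))
    predecessor (suc j) j<2n = j , ℕ.<-trans (ℕ.n<1+n j) j<2n , iter-suc rotate base j

    value-arc : ∀ y → value (arc G y) ≡ value y
    value-arc y with position y in eq
    ... | j , j<2n , inj₂ refl = trans (value-rotate j<2n) (value-exit j<2n)
    ... | j , j<2n , inj₁ refl with predecessor j j<2n
    ...   | k , k<2n , eq′ = begin
      value (arc G (entry j))                     ≡⟨ cong (value ∘ arc G) eq′ ⟩
      value (arc G (rotate (entry k)))            ≡⟨ cong value (arc-involutive G _) ⟩
      value (acrossEnd (entry k))                 ≡⟨ value-rotate k<2n ⟨
      value (rotate (entry k))                    ≡⟨ cong value eq′ ⟨
      value (entry j)                             ≡⟨ value-entry j<2n ⟩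
      b xor total x (edges base j)                ∎

    value-potential : Potential x value
    value-potential = record { jump = value-jump ; along = value-arc }

    value-base : value base ≡ b
    value-base = trans (value-entry {0} z<s) (xor-identityʳ b)

  -- Colourings of boundary components and the kernel of M[A]

  module _ (A : Subset (suc m)) where

    difference : (Flag (suc m) → Bool) → Fin (suc m) → Bool
    difference c e = c (e , false , false) xor c (e , false , true)

    invariant-free : (c : Invariant (arc G) (free A)) → ∀ {e} i s →
      (lookup A e ≡ true → colour c (e , not i , s) ≡ colour c (e , i , s)) ×
      (lookup A e ≡ false → colour c (e , i , not s) ≡ colour c (e , i , s))
    invariant-free c {e} i s with lookup A e in eq | invᵇ c (e , i , s)
    ... | true  | p = (λ _ → p) , λ ()
    ... | false | p = (λ ()) , λ _ → p

    -- The jump is read off at end `false` and must agree at end `true`. For e in A the sides carry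
    -- the colours from one end to the other; for e outside A both jumps are zero.
    colour-potential : (c : Invariant (arc G) (free A)) → Potential (difference (colour c)) (colour c)
    colour-potential c = record { jump = λ (e , i , s) → jump′ e i s ; along = invᵃ c }
      where
      xor-undo : ∀ a b → b ≡ a xor (a xor b)
      xor-undo a b = trans (cong (_xor b) (sym (xor-same a))) (xor-assoc a a b)
      at-false : ∀ e s → colour c (e , false , not s) ≡ colour c (e , false , s) xor difference (colour c) e
      at-false e false = xor-undo (colour c (e , false , false)) (colour c (e , false , true))
      at-false e true  = trans (xor-undo (colour c (e , false , true)) (colour c (e , false , false)))
        (cong (colour c (e , false , true) xor_) (xor-comm (colour c (e , false , true)) (colour c (e , false , false))))
      jump′ : ∀ e i s → colour c (e , i , not s) ≡ colour c (e , i , s) xor difference (colour c) e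
      jump′ e false s = at-false e s
      jump′ e true  s with lookup A e in eq
      ... | true  = trans (proj₁ (invariant-free c false (not s)) eq) (trans (at-false e s)
                      (cong (_xor difference (colour c) e) (sym (proj₁ (invariant-free c false s) eq))))
      ... | false = trans (proj₂ (invariant-free c true s) eq) (trans (sym (xor-identityʳ _))
                      (cong (colour c (e , true , s) xor_) (sym zero-difference)))
        where
        zero-difference : difference (colour c) e ≡ false
        zero-difference = trans (cong (colour c (e , false , false) xor_) (proj₂ (invariant-free c false false) eq))
          (xor-same (colour c (e , false , false)))

    xor-self⇒false : ∀ {a b} → a ≡ a xor b → b ≡ false
    xor-self⇒false {false} {b} eq = sym eq
    xor-self⇒false {true} {false} eq = refl

    -- The bit is the colour of `base`. Invariance under `free A` splits by edge: outside A the jump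
    -- is zero, which is the support condition, and inside A the two ends of a side agree, which by
    -- `row-potential` is the vanishing of the row.
    colourings-kernel : Inverse (Colourings (arc G) (free A)) (×-setoid (setoid Bool) (Ker (SI B) A))
    colourings-kernel = record
      { to        = to
      ; from      = from
      ; to-cong   = λ {c} {d} → to-cong {c} {d}
      ; from-cong = λ {x} {y} → from-cong {x} {y}
      ; inverse   =
          (λ {(b , x)} {c} eq →
             trans (eq base) (value-base b (vector x)) ,
             λ e → trans (cong₂ _xor_ (eq (e , false , false)) (eq (e , false , true))) (difference-value b (vector x) e))
        , (λ {c} {(b , x)} (eq , eqs) → potential-unique (value-potential b (vector x)) (colour-potential c) eqs
             (trans (value-base b (vector x)) eq))
      }
      where
      open FromVector

      to : Invariant (arc G) (free A) → Bool × Kernel (SI B) A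
      to c = colour c base , record
        { vector    = difference (colour c)
        ; supported = λ e e∉A → xor-self⇒false (trans (sym (proj₂ (invariant-free c false false) e∉A))
            (jump (colour-potential c) (e , false , false)))
        ; null      = λ e e∈A → xor-self⇒false (trans (sym (proj₁ (invariant-free c false false) e∈A))
            (row-potential (colour-potential c) e false))
        }

      from : Bool × Kernel (SI B) A → Invariant (arc G) (free A)
      from (b , x) = record { colour = value b (vector x) ; invᵃ = value-arc b (vector x) ; invᵇ = inv }
        where
        side-eq : ∀ e s → lookup A e ≡ true → value b (vector x) (e , true , s) ≡ value b (vector x) (e , false , s)
        side-eq e s e∈A = trans (row-potential (value-potential b (vector x)) e s)
          (trans (cong (value b (vector x) (e , false , s) xor_) (null x e e∈A)) (xor-identityʳ _))
        inv : ∀ y → value b (vector x) (free A y) ≡ value b (vector x) y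
        inv (e , i , s) with lookup A e in eq
        inv (e , false , s) | true = side-eq e s eq
        inv (e , true , s)  | true = sym (side-eq e s eq)
        ... | false = trans (value-jump b (vector x) (e , i , s))
          (trans (cong (value b (vector x) (e , i , s) xor_) (supported x e eq)) (xor-identityʳ _))

      to-cong : ∀ {c d} → colour c ≗ colour d → (colour c base ≡ colour d base) × difference (colour c) ≗ difference (colour d)
      to-cong eq = eq base , λ e → cong₂ _xor_ (eq (e , false , false)) (eq (e , false , true))

      from-cong : ∀ {x y} → (proj₁ x ≡ proj₁ y) × (vector (proj₂ x) ≗ vector (proj₂ y)) →
                  value (proj₁ x) (vector (proj₂ x)) ≗ value (proj₁ y) (vector (proj₂ y))
      from-cong {b , x} {d , y} (eq , eqs) = potential-unique (value-potential b (vector x)) (value-potential d (vector y)) eqs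
        (trans (value-base b (vector x)) (trans eq (sym (value-base d (vector y)))))

      difference-value : ∀ b x e → difference (value b x) e ≡ x e
      difference-value b x e = trans (cong (value b x (e , false , false) xor_) (value-jump b x (e , false , false)))
        (trans (sym (xor-assoc (value b x (e , false , false)) _ _)) (cong (_xor x e) (xor-same (value b x (e , false , false)))))

  -- Conjugation by `exchange A` carries the curves of `arc G` and `free A′` to those of
  -- `arc (G ^ A)` and τ. It is applied with τ = `acrossEnd`, A′ = A for vertices and with τ =
  -- `alongSide`, A′ = ∁ A for boundary components.
  corank-curves : ∀ {A τ} → (∀ y → τ (τ y) ≡ y) → (∀ y → τ y ≢ y) → (A′ : Subset (suc m)) →
    (∀ y → exchange A (free A′ y) ≡ τ (exchange A y)) → Corank (SI B) A′ (#curves (arc (G ^ A)) τ + isolated G)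
  corank-curves {A} {τ} ττ τ≢ A′ conj = subst (Corank (SI B) A′)
    (trans (sym (ℕ.+-identityʳ _)) (cong (#curves (arc (G ^ A)) τ +_) (sym isolated≡0)))
    (symᴵ (colourings-kernel A′) ∘ᴵ (conjugate ∘ᴵ
      Curves.colourings-of-curves (arc (G ^ A)) τ (arc-involutive (G ^ A)) ττ (arc-fixfree (G ^ A)) τ≢))
    where
    σ = exchange A
    σσ = exchange-involutive A
    conjugate : Inverse (Colourings (arc G) (free A′)) (Colourings (arc (G ^ A)) τ)
    conjugate = record
      { to = λ c → record
        { colour = colour c ∘ σ
        ; invᵃ   = λ y → trans (cong (colour c) (σσ _)) (invᵃ c (σ y))
        ; invᵇ   = λ y → trans (cong (colour c ∘ σ ∘ τ) (sym (σσ y))) (trans (cong (colour c ∘ σ) (sym (conj (σ y))))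
                     (trans (cong (colour c) (σσ _)) (invᵇ c (σ y))))
        }
      ; from = λ c → record
        { colour = colour c ∘ σ
        ; invᵃ   = λ y → trans (cong (colour c ∘ σ ∘ arc G) (sym (σσ y))) (invᵃ c (σ y))
        ; invᵇ   = λ y → trans (cong (colour c) (conj y)) (invᵇ c (σ y))
        }
      ; to-cong = λ eq y → eq (σ y)
      ; from-cong = λ eq y → eq (σ y)
      ; inverse = (λ {c} eq y → trans (eq (σ y)) (cong (colour c) (σσ y))) , (λ {c} eq y → trans (eq (σ y)) (cong (colour c) (σσ y)))
      }

exchange-acrossEnd : ∀ (A : Subset n) y → exchange A (free A y) ≡ acrossEnd (exchange A y)
exchange-acrossEnd A (e , i , s) with lookup A e in eq
... | true  rewrite eq = refl
... | false rewrite eq = refl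

exchange-alongSide : ∀ (A : Subset n) y → exchange A (free (∁ A) y) ≡ alongSide (exchange A y)
exchange-alongSide A (e , i , s) rewrite lookup-∁ A e with lookup A e in eq
... | true  rewrite eq = refl
... | false rewrite eq = refl

-- Without edges there are no flags: the kernel is trivial, only the base bit remains, and the
-- single disc is the one recorded in `isolated`.
Corank-empty : ∀ {SG : SignedGraph 0} {A v} → v ≡ 1 → Corank SG A v
Corank-empty refl = record
  { to        = λ (b , _) _ → b
  ; from      = λ g → g zero , record { vector = λ () ; supported = λ () ; null = λ () }
  ; to-cong   = λ (eq , _) _ → eq
  ; from-cong = λ eq → eq zero , λ ()
  ; inverse   = (λ { eq zero → proj₁ eq }) , (λ eq → eq zero , λ ())
  }

corank-vertices : ∀ (B : Bouquet n) A → Corank (SI B) A (#vertices (graph B ^ A))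
corank-vertices {zero}  B A = Corank-empty (one-vertex B)
corank-vertices {suc m} B A = Tour.corank-curves B {A} {acrossEnd} acrossEnd-involutive acrossEnd-fixfree A (exchange-acrossEnd A)

corank-boundaries : ∀ (B : Bouquet n) A → Corank (SI B) (∁ A) (#boundaries (graph B ^ A))
corank-boundaries {zero}  B A = Corank-empty (one-vertex B)
corank-boundaries {suc m} B A = Tour.corank-curves B {A} {alongSide} alongSide-involutive alongSide-fixfree (∁ A) (exchange-alongSide A)

-- Sums over subsets

coeff-⊕ : ∀ p q k → coeff (p ⊕ q) k ≡ coeff p k + coeff q k
coeff-⊕ []      q       k       = refl
coeff-⊕ (a ∷ p) []      k       = sym (ℕ.+-identityʳ _)
coeff-⊕ (a ∷ p) (b ∷ q) zero    = refl
coeff-⊕ (a ∷ p) (b ∷ q) (suc k) = coeff-⊕ p q k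

coeff-map-* : ∀ c p k → coeff (map (c *_) p) k ≡ c * coeff p k
coeff-map-* c []      k       = sym (ℕ.*-zeroʳ c)
coeff-map-* c (a ∷ p) zero    = refl
coeff-map-* c (a ∷ p) (suc k) = coeff-map-* c p k

-- Multiplication by z, on coefficient sequences.
shift : (ℕ → ℕ) → ℕ → ℕ
shift f zero    = 0
shift f (suc k) = f k

coeff-[0] : ∀ k → coeff (0 ∷ []) k ≡ 0
coeff-[0] zero    = refl
coeff-[0] (suc k) = refl

coeff-z²⊛ : ∀ c p k → coeff ((c z^ 2) ⊛ p) k ≡ shift (shift (λ k → c * coeff p k)) k
coeff-z²⊛ c p zero          = trans (coeff-⊕ (map (0 *_) p) _ 0) (cong (_+ 0) (coeff-map-* 0 p 0))
coeff-z²⊛ c p (suc zero)    = trans (coeff-⊕ (map (0 *_) p) _ 1) (cong₂ _+_ (coeff-map-* 0 p 1)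
  (trans (coeff-⊕ (map (0 *_) p) _ 0) (cong (_+ 0) (coeff-map-* 0 p 0))))
coeff-z²⊛ c p (suc (suc k)) = begin
  coeff (map (0 *_) p ⊕ (0 ∷ (map (0 *_) p ⊕ (0 ∷ (map (c *_) p ⊕ (0 ∷ [])))))) (2 + k)
    ≡⟨ coeff-⊕ (map (0 *_) p) _ (2 + k) ⟩
  coeff (map (0 *_) p) (2 + k) + coeff (map (0 *_) p ⊕ (0 ∷ (map (c *_) p ⊕ (0 ∷ [])))) (1 + k)
    ≡⟨ cong₂ _+_ (coeff-map-* 0 p (2 + k)) (coeff-⊕ (map (0 *_) p) _ (1 + k)) ⟩
  coeff (map (0 *_) p) (1 + k) + coeff (map (c *_) p ⊕ (0 ∷ [])) k
    ≡⟨ cong₂ _+_ (coeff-map-* 0 p (1 + k)) (coeff-⊕ (map (c *_) p) _ k) ⟩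
  coeff (map (c *_) p) k + coeff (0 ∷ []) k
    ≡⟨ cong₂ _+_ (coeff-map-* c p k) (coeff-[0] k) ⟩
  c * coeff p k + 0
    ≡⟨ ℕ.+-identityʳ _ ⟩
  c * coeff p k ∎
  where open ≡-Reasoning

∑ₛ : (Subset n → ℕ) → ℕ
∑ₛ {n} φ = ℕ.sum (map φ (subsets n))

∑ₛ-cong : ∀ {φ ψ : Subset n → ℕ} → φ ≗ ψ → ∑ₛ φ ≡ ∑ₛ ψ
∑ₛ-cong {n} eq = cong ℕ.sum (map-cong eq (subsets n))

∑ₛ-∷ : ∀ (φ : Subset (suc n) → ℕ) → ∑ₛ φ ≡ ∑ₛ (φ ∘ (outside Vec.∷_)) + ∑ₛ (φ ∘ (inside Vec.∷_))
∑ₛ-∷ {n} φ = begin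
  ℕ.sum (map φ (map (outside Vec.∷_) (subsets n) ++ map (inside Vec.∷_) (subsets n)))
    ≡⟨ cong ℕ.sum (map-++ φ (map (outside Vec.∷_) (subsets n)) _) ⟩
  ℕ.sum (map φ (map (outside Vec.∷_) (subsets n)) ++ map φ (map (inside Vec.∷_) (subsets n)))
    ≡⟨ ℕ.sum-++ (map φ (map (outside Vec.∷_) (subsets n))) _ ⟩
  ℕ.sum (map φ (map (outside Vec.∷_) (subsets n))) + ℕ.sum (map φ (map (inside Vec.∷_) (subsets n)))
    ≡⟨ cong₂ (λ k l → ℕ.sum k + ℕ.sum l) (map-∘ (subsets n)) (map-∘ (subsets n)) ⟨
  ∑ₛ (φ ∘ (outside Vec.∷_)) + ∑ₛ (φ ∘ (inside Vec.∷_)) ∎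
  where open ≡-Reasoning

-- `subsets` branches on the first element only; for any other v the split is moved inwards and the
-- four partial sums are regrouped.
∑ₛ-insertAt : ∀ (v : Fin (suc n)) (φ : Subset (suc n) → ℕ) →
  ∑ₛ φ ≡ ∑ₛ (λ A → φ (insertAt A v false)) + ∑ₛ (λ A → φ (insertAt A v true))
∑ₛ-insertAt zero φ = ∑ₛ-∷ φ
∑ₛ-insertAt {suc n} (suc v) φ = begin
  ∑ₛ φ
    ≡⟨ ∑ₛ-∷ φ ⟩
  ∑ₛ (φ ∘ (outside Vec.∷_)) + ∑ₛ (φ ∘ (inside Vec.∷_))
    ≡⟨ cong₂ _+_ (∑ₛ-insertAt v (φ ∘ (outside Vec.∷_))) (∑ₛ-insertAt v (φ ∘ (inside Vec.∷_))) ⟩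
  (∑ₛ (φ⟨ outside , false ⟩) + ∑ₛ (φ⟨ outside , true ⟩)) + (∑ₛ (φ⟨ inside , false ⟩) + ∑ₛ (φ⟨ inside , true ⟩))
    ≡⟨ interchange (∑ₛ (φ⟨ outside , false ⟩)) _ _ _ ⟩
  (∑ₛ (φ⟨ outside , false ⟩) + ∑ₛ (φ⟨ inside , false ⟩)) + (∑ₛ (φ⟨ outside , true ⟩) + ∑ₛ (φ⟨ inside , true ⟩))
    ≡⟨ cong₂ _+_ (∑ₛ-∷ (λ A → φ (insertAt A (suc v) false))) (∑ₛ-∷ (λ A → φ (insertAt A (suc v) true))) ⟨
  ∑ₛ (λ A → φ (insertAt A (suc v) false)) + ∑ₛ (λ A → φ (insertAt A (suc v) true)) ∎
  where
  open ≡-Reasoning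
  φ⟨_,_⟩ : Bool → Bool → Subset n → ℕ
  φ⟨ s , b ⟩ A = φ (s Vec.∷ insertAt A v b)

subsets-complete : ∀ (A : Subset n) → A ∈ˡ subsets n
subsets-complete Vec.[]             = here refl
subsets-complete (false Vec.∷ A)    = ∈-++⁺ˡ (∈-map⁺ _ (subsets-complete A))
subsets-complete (true Vec.∷ A)     = ∈-++⁺ʳ _ (∈-map⁺ _ (subsets-complete A))

subsets-unique : ∀ n → Unique (subsets n)
subsets-unique zero    = [] ∷ []
subsets-unique (suc n) = Unique.++⁺ (Unique.map⁺ Vec.∷-injectiveʳ (subsets-unique n))
  (Unique.map⁺ Vec.∷-injectiveʳ (subsets-unique n)) disjoint
  where
  disjoint : ∀ {A} → A ∈ˡ map (outside Vec.∷_) (subsets n) × A ∈ˡ map (inside Vec.∷_) (subsets n) → _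
  disjoint (p , q) with ∈-map⁻ _ p | ∈-map⁻ _ q
  ... | _ , _ , refl | _ , _ , ()

-- `subsets` lists every subset exactly once, so its image under a bijection is a permutation of it.
-- This renames the edges of a bouquet as the vertices of SG.
∑ₛ-bijection : ∀ (φ : Subset n → ℕ) (f g : Subset n → Subset n) →
  (∀ A → f (g A) ≡ A) → (∀ A → g (f A) ≡ A) → ∑ₛ φ ≡ ∑ₛ (φ ∘ f)
∑ₛ-bijection {n} φ f g fg gf = begin
  ℕ.sum (map φ (subsets n))          ≡⟨ ℕ.sum-↭ (↭.map⁺ φ permuted) ⟩
  ℕ.sum (map φ (map f (subsets n)))  ≡⟨ cong ℕ.sum (map-∘ (subsets n)) ⟨
  ℕ.sum (map (φ ∘ f) (subsets n))    ∎
  where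
  open ≡-Reasoning
  permuted : subsets n ↭ map f (subsets n)
  permuted = ∼bag⇒↭ (unique∧set⇒bag (subsets-unique n)
    (Unique.map⁺ (λ {A} {B} eq → trans (sym (gf A)) (trans (cong g eq) (gf B))) (subsets-unique n))
    (λ {A} → mk⇔ (λ _ → subst (_∈ˡ map f (subsets n)) (fg A) (∈-map⁺ f (subsets-complete (g A))))
                 (λ _ → subsets-complete A)))

coeff-foldr : ∀ {X : Set} (P : X → Poly) l k → coeff (foldr _⊕_ [] (map P l)) k ≡ ℕ.sum (map (λ x → coeff (P x) k) l)
coeff-foldr P []      k = refl
coeff-foldr P (x ∷ l) k = trans (coeff-⊕ (P x) _ k) (cong (coeff (P x) k +_) (coeff-foldr P l k))

-- g is rank M[A] + rank M[∁ A], where M is the adjacency matrix of SG over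
-- GF(2) with ones on the diagonal at the negative vertices.
Genus : SignedGraph n → Subset n → ℕ → Set
Genus {n} SG A g = ∃₂ λ v f → Corank SG A v × Corank SG (∁ A) f × g ≡ (2 + n) ∸ (v + f)

-- No bouquet occurs here. Coranks are unique, so `Genus` determines each γ A from SG, and
-- polynomials coming from different bouquets become comparable.
CountsGenera : SignedGraph n → Poly → Set
CountsGenera {n} SG p = ∃ λ (γ : Subset n → ℕ) →
  (∀ A → Genus SG A (γ A)) × (∀ k → coeff p k ≡ ∑ₛ (λ A → coeff (1 z^ γ A) k))

opaque
  IP-genus : ∀ (SG : SignedGraph n) (h : IsSignedIntersectionGraph SG) → CountsGenera SG (IP SG h)
  IP-genus {n} SG (B , iso) = (λ A → eulerGenus (graph B ^ ρ A)) , genus , λ k →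
    trans (coeff-foldr (λ A → 1 z^ eulerGenus (graph B ^ A)) (subsets n) k)
      (∑ₛ-bijection (λ A → coeff (1 z^ eulerGenus (graph B ^ A)) k) ρ ρ⁻¹ ρρ⁻¹ ρ⁻¹ρ)
    where
    open _≅_ iso renaming (bijection to π)
    ρ : Subset n → Subset n
    ρ = reindex iso
    ρ⁻¹ : Subset n → Subset n
    ρ⁻¹ A = tabulate (λ u → lookup A (π ⟨$⟩ʳ u))
    ρρ⁻¹ : ∀ A → ρ (ρ⁻¹ A) ≡ A
    ρρ⁻¹ A = trans (Vec.tabulate-cong (λ u →
      trans (Vec.lookup∘tabulate _ (π ⟨$⟩ˡ u)) (cong (lookup A) (Perm.inverseʳ π)))) (Vec.tabulate∘lookup A)
    ρ⁻¹ρ : ∀ A → ρ⁻¹ (ρ A) ≡ A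
    ρ⁻¹ρ A = trans (Vec.tabulate-cong (λ u →
      trans (Vec.lookup∘tabulate _ (π ⟨$⟩ʳ u)) (cong (lookup A) (Perm.inverseˡ π)))) (Vec.tabulate∘lookup A)
    ρ-∁ : ∀ A → ∁ (ρ A) ≡ ρ (∁ A)
    ρ-∁ A = trans (sym (Vec.tabulate-∘ not (λ u → lookup A (π ⟨$⟩ˡ u))))
      (Vec.tabulate-cong (λ u → sym (lookup-∁ A (π ⟨$⟩ˡ u))))
    genus : ∀ A → Genus SG A (eulerGenus (graph B ^ ρ A))
    genus A = #vertices (graph B ^ ρ A) , #boundaries (graph B ^ ρ A)
      , symᴵ (×Bool (Ker-≅ iso A)) ∘ᴵ corank-vertices B (ρ A)
      , symᴵ (×Bool (Ker-≅ iso (∁ A))) ∘ᴵ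
          subst (λ A′ → Corank (SI B) A′ (#boundaries (graph B ^ ρ A))) (ρ-∁ A) (corank-boundaries B (ρ A))
      , refl

-- Genera in the four cases at a positive leaf

∁-insertAt : ∀ (A : Subset n) v b → ∁ (insertAt A v b) ≡ insertAt (∁ A) v (not b)
∁-insertAt A v b = Vec.map-insertAt not b A v

-- The sum of the two ranks is symmetric. The cases with v₁ in A are thereby reduced to those with
-- v₁ outside A.
Genus-∁ : ∀ {SG : SignedGraph n} {A g} → Genus SG A g → Genus SG (∁ A) g
Genus-∁ {n} {SG} {A} (v , f , p , q , eq) =
  f , v , q , subst (λ A → Corank SG A v) (sym ∁∁) p , trans eq (cong (2 + n ∸_) (ℕ.+-comm v f))
  where
  ∁∁ : ∁ (∁ A) ≡ A
  ∁∁ = trans (sym (Vec.map-∘ not not A)) (trans (Vec.map-cong not-involutive A) (Vec.map-id A))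

-- Two vertices disappear while both coranks stay, so the sum of the ranks drops by 2. Pulling the 2
-- out of the truncated subtraction uses `Corank-complementary`.
Genus-both : ∀ {SG : SignedGraph (2 + n)} {SH : SignedGraph n} {A B g h} →
  Inverse (Ker SG A) (Ker SH B) → Inverse (Ker SG (∁ A)) (Ker SH (∁ B)) →
  Genus SG A g → Genus SH B h → g ≡ 2 + h
Genus-both {n} i j (v , f , p , q , refl) (v′ , f′ , p′ , q′ , refl)
  rewrite Corank-unique i p p′ | Corank-unique j q q′ = ℕ.+-∸-assoc 2 (Corank-complementary p′ q′)

-- The additional vertex is paid for by one additional dimension of the kernel on the complementary
-- side.
Genus-one : ∀ {SG : SignedGraph (suc n)} {SH : SignedGraph n} {A B g h} →
  Inverse (Ker SG A) (Ker SH B) → Inverse (Ker SG (∁ A)) (×-setoid (setoid Bool) (Ker SH (∁ B))) →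
  Genus SG A g → Genus SH B h → g ≡ h
Genus-one {n} i j (v , f , p , q , refl) (v′ , f′ , p′ , q′ , refl)
  rewrite Corank-unique i p p′ | Corank-suc j q q′ = cong (3 + n ∸_) (ℕ.+-suc v′ f′)

module _ (SG : SignedGraph (suc (suc n))) (v : Fin (suc (suc n))) (w : Fin (suc n))
  (v+ : sign SG v ≡ Sign.+) (vw : adj SG v (punchIn v w) ≡ true)
  (leaf : ∀ u → adj SG v (punchIn v (punchIn w u)) ≡ false) where

  private
    SG₁  = SG - v
    SG₁₂ = SG - v - w

    ∁₂ : ∀ (A : Subset n) a b → ∁ (insertAt (insertAt A w a) v b) ≡ insertAt (insertAt (∁ A) w (not a)) v (not b)
    ∁₂ A a b = trans (∁-insertAt (insertAt A w a) v b) (cong (λ A → insertAt A v (not b)) (∁-insertAt A w a))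

  -- On the side of A both vertices are simply deleted; the complement contains the leaf together
  -- with its neighbour, which is the situation of `Ker-leaf`.
  genus-neither : ∀ A {g h} → Genus SG (insertAt (insertAt A w false) v false) g → Genus SG₁₂ A h → g ≡ 2 + h
  genus-neither A = Genus-both
    (Ker-delete SG v (insertAt A w false) ∘ᴵ Ker-delete SG₁ w A)
    (subst (λ X → Inverse (Ker SG X) (Ker SG₁₂ (∁ A))) (sym (∁₂ A false false)) (Ker-leaf SG v w v+ vw leaf (∁ A)))

  genus-both : ∀ A {g h} → Genus SG (insertAt (insertAt A w true) v true) g → Genus SG₁₂ A h → g ≡ 2 + h
  genus-both A p q = genus-neither (∁ A) (subst (λ X → Genus SG X _) (∁₂ A true true) (Genus-∁ p)) (Genus-∁ q)

  -- The complement contains the leaf but not its only neighbour, so the leaf is isolated there.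
  genus-neighbour : ∀ A {g h} → Genus SG (insertAt (insertAt A w true) v false) g → Genus SG₁ (insertAt A w true) h → g ≡ h
  genus-neighbour A = Genus-one (Ker-delete SG v (insertAt A w true))
    (subst₂ (λ X Y → Inverse (Ker SG X) (×-setoid (setoid Bool) (Ker SG₁ Y))) (sym (∁₂ A true false)) (sym (∁-insertAt A w true))
      (Ker-isolated SG v v+ (insertAt (∁ A) w false) (punchIn-elim w _
        (λ w∈ → contradiction (trans (sym w∈) (Vec.insertAt-lookup (∁ A) w false)) λ ())
        (λ u _ → leaf u))))

  genus-leaf : ∀ A {g h} → Genus SG (insertAt (insertAt A w false) v true) g → Genus SG₁ (insertAt A w false) h → g ≡ h
  genus-leaf A p q = genus-neighbour (∁ A) (subst (λ X → Genus SG X _) (∁₂ A false true) (Genus-∁ p))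
    (subst (λ X → Genus SG₁ X _) (∁-insertAt A w false) (Genus-∁ q))

  recurrence : ∀ p p₁ p₁₂ → CountsGenera SG p → CountsGenera SG₁ p₁ → CountsGenera SG₁₂ p₁₂ →
    p ≈ p₁ ⊕ (2 z^ 2) ⊛ p₁₂
  recurrence p p₁ p₁₂ (γ , genus , p≡) (γ₁ , genus₁ , p₁≡) (γ₁₂ , genus₁₂ , p₁₂≡) k = begin
    coeff p k
      ≡⟨ p≡ k ⟩
    ∑ₛ φ
      ≡⟨ ∑ₛ-insertAt v φ ⟩
    ∑ₛ (λ A → φ (insertAt A v false)) + ∑ₛ (λ A → φ (insertAt A v true))
      ≡⟨ cong₂ _+_ (∑ₛ-insertAt w (λ A → φ (insertAt A v false))) (∑ₛ-insertAt w (λ A → φ (insertAt A v true))) ⟩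
    (∑ₛ (λ A → φ (insertAt (insertAt A w false) v false)) + ∑ₛ (λ A → φ (insertAt (insertAt A w true) v false)))
    + (∑ₛ (λ A → φ (insertAt (insertAt A w false) v true)) + ∑ₛ (λ A → φ (insertAt (insertAt A w true) v true)))
      ≡⟨ cong₂ _+_
          (cong₂ _+_ (∑ₛ-cong (λ A → coeff-cong (genus-neither A (genus _) (genus₁₂ A))))
                     (∑ₛ-cong (λ A → coeff-cong (genus-neighbour A (genus _) (genus₁ _)))))
          (cong₂ _+_ (∑ₛ-cong (λ A → coeff-cong (genus-leaf A (genus _) (genus₁ _))))
                     (∑ₛ-cong (λ A → coeff-cong (genus-both A (genus _) (genus₁₂ A))))) ⟩
    -- The sum c appears once for v₁ and v₂ both outside A and once for both inside, which is the
    -- factor 2; the exponent 2 is the loss of rank. The mixed sums a and b together run over all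
    -- subsets of the graph without v₁.
    (c + b) + (a + c)
      ≡⟨ regroup a b c ⟩
    (a + b) + 2 * c
      ≡⟨ cong₂ _+_ (trans (sym (∑ₛ-insertAt w (λ A → coeff (1 z^ γ₁ A) k))) (sym (p₁≡ k))) (shifted k) ⟩
    coeff p₁ k + coeff ((2 z^ 2) ⊛ p₁₂) k
      ≡⟨ coeff-⊕ p₁ _ k ⟨
    coeff (p₁ ⊕ (2 z^ 2) ⊛ p₁₂) k ∎
    where
    open ≡-Reasoning
    coeff-cong : ∀ {g h} → g ≡ h → coeff (1 z^ g) k ≡ coeff (1 z^ h) k
    coeff-cong = cong (λ g → coeff (1 z^ g) k)
    φ : Subset (2 + n) → ℕ
    φ A = coeff (1 z^ γ A) k
    a = ∑ₛ (λ A → coeff (1 z^ γ₁ (insertAt A w false)) k)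
    b = ∑ₛ (λ A → coeff (1 z^ γ₁ (insertAt A w true)) k)
    c = ∑ₛ (λ A → coeff (1 z^ (2 + γ₁₂ A)) k)
    regroup : ∀ a b c → (c + b) + (a + c) ≡ (a + b) + 2 * c
    regroup = solve-∀
    ∑ₛ-zero : ∑ₛ {n} (λ _ → 0) ≡ 0
    ∑ₛ-zero = zero-sum (subsets n)
      where
      zero-sum : ∀ {X : Set} (l : List X) → ℕ.sum (map (λ _ → 0) l) ≡ 0
      zero-sum []      = refl
      zero-sum (_ ∷ l) = zero-sum l
    shifted : ∀ k → 2 * ∑ₛ (λ A → coeff (1 z^ (2 + γ₁₂ A)) k) ≡ coeff ((2 z^ 2) ⊛ p₁₂) k
    shifted zero          = trans (cong (2 *_) ∑ₛ-zero) (sym (coeff-z²⊛ 2 p₁₂ 0))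
    shifted (suc zero)    = trans (cong (2 *_) ∑ₛ-zero) (sym (coeff-z²⊛ 2 p₁₂ 1))
    shifted (suc (suc k)) = trans (cong (2 *_) (sym (p₁₂≡ k))) (sym (coeff-z²⊛ 2 p₁₂ (2 + k)))

theorem14 :
    ∀ {n : ℕ} (SG : SignedGraph (suc (suc n))) (v₁ v₂ : Fin (suc (suc n)))
    (v₁v₂ : Adjacent SG v₁ v₂) →
    degree SG v₁ ≡ 1 →
    sign SG v₁ ≡ Sign.+ →
    let SG₁  = SG - v₁
        SG₁₂ = SG - v₁ - punchOut (Adjacent⇒≢ SG v₁v₂)
    in
    (h   : IsSignedIntersectionGraph SG)
    (h₁  : IsSignedIntersectionGraph SG₁)
    (h₁₂ : IsSignedIntersectionGraph SG₁₂) →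
    IP SG h ≈ IP SG₁ h₁ ⊕ (2 z^ 2) ⊛ IP SG₁₂ h₁₂
theorem14 SG v₁ v₂ v₁v₂ deg v₁+ h h₁ h₁₂ = recurrence SG v₁ w v₁+ (trans (cong (adj SG v₁) v₂≡) v₁v₂) leaf
  (IP SG h) (IP (SG - v₁) h₁) (IP (SG - v₁ - w) h₁₂) (IP-genus SG h) (IP-genus (SG - v₁) h₁) (IP-genus (SG - v₁ - w) h₁₂)
  where
  w = punchOut (Adjacent⇒≢ SG v₁v₂)
  v₂≡ : punchIn v₁ w ≡ v₂
  v₂≡ = Fin.punchIn-punchOut (Adjacent⇒≢ SG v₁v₂)
  leaf : ∀ u → adj SG v₁ (punchIn v₁ (punchIn w u)) ≡ false
  leaf u = degree-1⇒leaf SG deg v₁v₂ (λ eq → Fin.punchInᵢ≢i w u (sym (Fin.punchIn-injective v₁ w _ (trans v₂≡ eq))))
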